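{- Let $D$ be a connected locally-finite digraph with exactly two ends. Then $D$ is connected-homogeneous if and only if it is isomorphic to $J(r)$ for some $r\in\mathbb{N}$.
   Context: A digraph is a set with an irreflexive antisymmetric arc relation $\to$; connectivity and ends refer to the underlying undirected graph (ends of a connected locally-finite graph are equivalence classes of rays, two rays being equivalent if some third ray meets each infinitely often). Locally-finite: every vertex has finitely many in- and out-neighbours. Connected-homogeneous: every isomorphism between finite connected induced subdigraphs extends to an automorphism. For $r\in\mathbb{N}$, $J(r)$ is the digraph with vertex set $\mathbb{Z}\times\{1,\dots,r\}$ and arcs $(i,x)\to(i+1,y)$ for all $i\in\mathbb{Z}$ and $x,y\in\{1,\dots,r\}$. -}

module Defs where

open import Data.Fin.Base using (Fin)
open import Data.Integer.Base using (ℤ) renaming (suc to sucℤ)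
import Data.Integer.Properties as ℤ
open import Data.List.Base using (List)
open import Data.List.Membership.Propositional using (_∈_)
open import Data.Nat.Base using (ℕ; suc; _≤_)
open import Data.Product.Base using (_×_; _,_; proj₁; Σ-syntax; ∃-syntax)
open import Data.Sum.Base using (_⊎_)
open import Function.Base using (_on_)
open import Function.Bundles using (_↔_; _↣_; _⇔_; Inverse; Injection)
open import Function.Definitions using (Injective)
open import Level using (Level; 0ℓ; _⊔_) renaming (suc to lsuc)
open import Relation.Binary.Construct.Closure.Equivalence using (EqClosure)
open import Relation.Binary.Construct.Closure.Symmetric using (SymClosure)
open import Relation.Binary.Core using (Rel)
open import Relation.Binary.Definitions using (Irreflexive; Antisymmetric)
open import Relation.Binary.PropositionalEquality.Core
  using (_≡_; refl; cong)
open import Relation.Nullary.Negation.Core using (¬_; contradiction)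
open import Relation.Unary using (Pred)

record Digraph (a ℓ : Level) : Set (lsuc (a ⊔ ℓ)) where
  infix 4 _⟶_
  field
    Vertex  : Set a
    _⟶_     : Rel Vertex ℓ
    irrefl  : Irreflexive _≡_ _⟶_
    antisym : Antisymmetric _≡_ _⟶_

  -- Adjacency in the underlying undirected graph.
  Adjacent : Rel Vertex ℓ
  Adjacent = SymClosure _⟶_

open Digraph using (Vertex; Adjacent)

infix 4 _≅_

record _≅_ {a ℓ a′ ℓ′ : Level} (D : Digraph a ℓ) (E : Digraph a′ ℓ′)
           : Set (a ⊔ ℓ ⊔ a′ ⊔ ℓ′) where
  private
    module D = Digraph D
    module E = Digraph E
  field
    bijection : D.Vertex ↔ E.Vertex
  open Inverse bijection public using (to; from)
  field
    arcs : ∀ u v → (u D.⟶ v) ⇔ (to u E.⟶ to v)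

Automorphism : {a ℓ : Level} → Digraph a ℓ → Set (a ⊔ ℓ)
Automorphism D = D ≅ D

-- EqClosure is the reflexive-transitive closure of SymClosure, so its
-- elements are the walks of the underlying undirected graph.
Connected : {a ℓ : Level} → Digraph a ℓ → Set (a ⊔ ℓ)
Connected D = ∀ u v → EqClosure (Digraph._⟶_ D) u v

Finite : {a ℓ : Level} {A : Set a} → Pred A ℓ → Set (a ⊔ ℓ)
Finite {A = A} P = Σ[ xs ∈ List A ] (∀ x → P x ⇔ x ∈ xs)

LocallyFinite : {a ℓ : Level} → Digraph a ℓ → Set (a ⊔ ℓ)
LocallyFinite D = ∀ v → Finite (λ u → v ⟶ u) × Finite (λ u → u ⟶ v)
  where open Digraph D

record Ray {a ℓ : Level} (D : Digraph a ℓ) : Set (a ⊔ ℓ) where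
  field
    at       : ℕ → Vertex D
    distinct : Injective _≡_ _≡_ at
    adjacent : ∀ n → Adjacent D (at n) (at (suc n))

-- The vertices of a ray are distinct, so having infinitely many vertices in
-- common is the same as infinitely many positions n of t with t n on s.
MeetsInfinitelyOften : {a ℓ : Level} {D : Digraph a ℓ} → Ray D → Ray D → Set a
MeetsInfinitelyOften t s =
  ∀ m → ∃[ n ] m ≤ n × (∃[ k ] Ray.at t n ≡ Ray.at s k)

RayEquivalent : {a ℓ : Level} {D : Digraph a ℓ} → Ray D → Ray D → Set (a ⊔ ℓ)
RayEquivalent {D = D} r s =
  Σ[ t ∈ Ray D ] MeetsInfinitelyOften t r × MeetsInfinitelyOften t s

-- In place of the quotient of rays by RayEquivalent: representatives of two
-- different classes, such that every ray lies in one of these classes.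
ExactlyTwoEnds : {a ℓ : Level} → Digraph a ℓ → Set (a ⊔ ℓ)
ExactlyTwoEnds D =
  Σ[ r ∈ Ray D ] Σ[ s ∈ Ray D ]
    (¬ RayEquivalent r s) ×
    (∀ (t : Ray D) → RayEquivalent t r ⊎ RayEquivalent t s)

-- The subdigraph induced on the image of an injection, with the image
-- identified with the domain.
induced : {a b ℓ : Level} (D : Digraph a ℓ) {B : Set b} →
          B ↣ Vertex D → Digraph b ℓ
induced D {B} ι = record
  { Vertex  = B
  ; _⟶_     = D._⟶_ on to
  ; irrefl  = λ u≡v → D.irrefl (cong to u≡v)
  ; antisym = λ u⟶v v⟶u → injective (D.antisym u⟶v v⟶u)
  }
  where
  module D = Digraph D
  open Injection ι using (to; injective)

-- A finite set of vertices is given by listing its elements without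
-- repetition, i.e. by an injection from some Fin n.  Hence φ is an
-- isomorphism between finite connected induced subdigraphs, taking the vertex
-- at position i of the first listing to the one at position φ i of the second.
ConnectedHomogeneous : {a ℓ : Level} → Digraph a ℓ → Set (a ⊔ ℓ)
ConnectedHomogeneous D =
  ∀ {m n : ℕ} (ι : Fin m ↣ Vertex D) (κ : Fin n ↣ Vertex D) →
  Connected (induced D ι) → Connected (induced D κ) →
  (φ : induced D ι ≅ induced D κ) →
  Σ[ α ∈ Automorphism D ]
    (∀ i → _≅_.to α (Injection.to ι i) ≡ Injection.to κ (_≅_.to φ i))

J : ℕ → Digraph 0ℓ 0ℓ
J r = record
  { Vertex  = ℤ × Fin r
  ; _⟶_     = λ u v → proj₁ v ≡ sucℤ (proj₁ u)
  ; irrefl  = λ { {i , _} refl i≡1+i → ℤ.i≢suc[i] i≡1+i }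
  ; antisym = λ { {i , _} {j , _} j≡1+i i≡1+j →
                  contradiction i≡1+j (no-2-cycle i j j≡1+i) }
  }
  where
  no-2-cycle : ∀ i j → j ≡ sucℤ i → ¬ (i ≡ sucℤ j)
  no-2-cycle i j refl i≡2+i =
    ℤ.<-irrefl i≡2+i
      (ℤ.<-trans (ℤ.suc[i]≤j⇒i<j ℤ.≤-refl) (ℤ.suc[i]≤j⇒i<j ℤ.≤-refl))

{-# OPTIONS --safe #-}

-- Some ball around every vertex x separates the two ends; let R x and L x be
-- the sets of vertices on its two sides.  Up to the sign of the action on the
-- ends, φ(u,v) = |R u \ R v| - |R v \ R u| + |L v \ L u| - |L u \ L v| is an
-- invariant cocycle, so it comes from a level function.  Its levels are finite:
-- φ(u,v) ≥ 1 if v is far to the right of u.  Being transitive on arcs, D changes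
-- the level by ±c along arcs, with c ≠ 0.  Hence a directed path of length two is
-- induced, and extending partial isomorphisms of such paths shows that the sign
-- is constant, so that arcs lead from each level to the next.
--
-- The stabiliser of a long directed path permutes the out-neighbours of its last
-- vertex transitively.  If in-neighbourhoods determined vertices, an automorphism
-- would be determined above a level by its permutation of that level, so there
-- would be too few automorphisms.  By homogeneity any two siblings therefore have
-- the same in-neighbours.  If they did not have the same out-neighbours, siblings
-- would have no common out-neighbour; but levels are finite, so the descendants
-- of distinct siblings do meet, and a shortest way to meet contradicts
-- homogeneity.  With the same for D reversed, each level is the set of
-- out-neighbours of any vertex of the previous one.

module Submission where

open import Defs
open import Axiom.ExcludedMiddle using (ExcludedMiddle)
open import Data.Bool.Base using (Bool; true; false; not)
open import Data.Empty using (⊥; ⊥-elim)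
open import Data.Fin.Base using (Fin; zero; suc; toℕ; funToFin; finToFun)
import Data.Fin.Properties as Fin
open import Data.Integer.Base as ℤ using (ℤ; +_; -[1+_]; 0ℤ; 1ℤ)
import Data.Integer.Properties as ℤ
import Algebra.Properties.AbelianGroup ℤ.+-0-abelianGroup as ℤ+
open import Data.Integer.Tactic.RingSolver using (solve-∀)
open import Data.List.Base
  using (List; []; _∷_; _++_; [_]; map; length; lookup; concatMap; deduplicate; filter;
    allFin; applyUpTo)
open import Data.List.Membership.Propositional using (_∈_; _∉_; find)
open import Data.List.Membership.Propositional.Properties
  using (∈-++⁺ˡ; ∈-++⁺ʳ; ∈-++⁻; ∈-∃++; ∈-lookup; ∈-allFin; ∈-deduplicate⁺;
    ∈-deduplicate⁻; ∈-map⁺; ∈-concatMap⁺; ∈-concatMap⁻; ∈-applyUpTo⁺; ∈-filter⁺;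
    ∈-filter⁻)
import Data.List.Properties as List
open import Data.List.Relation.Unary.All as All using (All; []; _∷_)
import Data.List.Relation.Unary.All.Properties as All
open import Data.List.Relation.Unary.AllPairs as AllPairs using ([]; _∷_)
open import Data.List.Relation.Unary.Any as Any using (here; there)
import Data.List.Relation.Unary.Any.Properties as Any
open import Data.List.Relation.Unary.Linked using (Linked; []; [-]; _∷_)
import Data.List.Relation.Unary.Unique.DecPropositional.Properties as Unique
open import Data.List.Relation.Unary.Unique.Propositional using (Unique)
import Data.List.Relation.Unary.Unique.Propositional.Properties as Unique
open import Data.Nat.Base as ℕ using (ℕ; zero; suc; _≤_; _<_; z≤n; s≤s)
open import Data.Nat.Induction using (<-rec)
import Data.Nat.Properties as ℕ
open import Data.Product.Base using (_×_; _,_; proj₁; proj₂; Σ-syntax; ∃; ∃-syntax)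
open import Data.Sum.Base using (_⊎_; inj₁; inj₂; [_,_]′)
open import Function.Base using (_∘_; id; flip; case_of_)
open import Function.Bundles
  using (_⇔_; _↣_; Equivalence; Inverse; Injection; mk⇔; mk↔ₛ′; mk↣)
open import Level using (Level; _⊔_; Lift; lift; lower)
open import Relation.Binary.Construct.Closure.ReflexiveTransitive using (Star; ε; _◅_)
open import Relation.Binary.Construct.Closure.Symmetric
  using (SymClosure; fwd; bwd; symmetric)
open import Relation.Binary.Core using (Rel)
open import Relation.Binary.Definitions using (DecidableEquality; tri<; tri≈; tri>)
open import Relation.Binary.PropositionalEquality
  using (_≡_; _≢_; refl; sym; trans; cong; cong₂; subst; subst₂)
open import Relation.Nullary.Decidable using (Dec; yes; no; map′; decidable-stable)
open import Relation.Nullary.Negation using (¬_; contradiction)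

-- The main obstacle is that an automorphism may interchange the two ends. The cocycle is therefore
-- invariant only up to a sign depending on the automorphism, and the level function alone does not
-- show that all arcs point the same way. The sign is controlled through an arc that is fixed: its
-- level difference is nonzero, so an automorphism fixing both of its vertices cannot reverse
-- levels. One radius serves for all vertices, because balls and their sides are carried along by
-- automorphisms; this is what makes the cocycle equivariant. The count of automorphisms runs as
-- follows. For every n some automorphism fixes a directed path up to its n-th vertex and moves the
-- next one. All of these act on the finite level of the first vertex, which has finitely many
-- self-maps, so two of them act alike there. They would then agree on everything above, although
-- one fixes a vertex that the other moves.

-- Lists and finite covers

dropLinked : ∀ {a ℓ} {A : Set a} {R : Rel A ℓ} (xs : List A) {ys : List A} →
             Linked R (xs ++ ys) → Linked R ys
dropLinked []           l       = l
dropLinked (x ∷ [])     [-]     = []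
dropLinked (x ∷ [])     (_ ∷ l) = l
dropLinked (x ∷ y ∷ xs) (_ ∷ l) = dropLinked (y ∷ xs) l

dropUnique : ∀ {a} {A : Set a} (xs : List A) {ys : List A} → Unique (xs ++ ys) → Unique ys
dropUnique []       u       = u
dropUnique (x ∷ xs) (_ ∷ u) = dropUnique xs u

module _ {a} {A : Set a} where

  uniqueHead : {x : A} {xs : List A} → Unique (x ∷ xs) → x ∉ xs
  uniqueHead (x≢ ∷ _) x∈xs = All.lookup x≢ x∈xs refl

  consUnique : {x : A} {xs : List A} → x ∉ xs → Unique xs → Unique (x ∷ xs)
  consUnique x∉xs u = All.¬Any⇒All¬ _ x∉xs ∷ u

  -- Finiteness as a mere cover: the list may repeat elements and contain others, so that subsets
  -- inherit it without any membership test.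
  Listed : ∀ {p} → (A → Set p) → Set (a ⊔ p)
  Listed P = Σ[ xs ∈ List A ] (∀ x → P x → x ∈ xs)

  listed-⊆ : ∀ {p q} {P : A → Set p} {Q : A → Set q} → (∀ x → P x → Q x) → Listed Q → Listed P
  listed-⊆ P⊆Q (xs , f) = xs , λ x → f x ∘ P⊆Q x

  listed-∪ : ∀ {p q} {P : A → Set p} {Q : A → Set q} →
             Listed P → Listed Q → Listed (λ x → P x ⊎ Q x)
  listed-∪ (xs , f) (ys , g) = xs ++ ys , λ x →
    [ ∈-++⁺ˡ ∘ f x , ∈-++⁺ʳ xs ∘ g x ]′

  listed-⋃ : ∀ {b p} {B : Set b} {Q : B → A → Set p} (l : List B) →
             (∀ b → b ∈ l → Listed (Q b)) → Listed (λ x → ∃[ b ] b ∈ l × Q b x)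
  listed-⋃ []      f = [] , λ { x (b , () , _) }
  listed-⋃ (b ∷ l) f with f b (here refl) | listed-⋃ l (λ c → f c ∘ there)
  ... | xs , p | ys , q = xs ++ ys , λ where
    x (c , here refl , Qcx) → ∈-++⁺ˡ (p x Qcx)
    x (c , there c∈l , Qcx) → ∈-++⁺ʳ xs (q x (c , c∈l , Qcx))

  -- Positions are counted from the end, so that they do not change when a
  -- list grows at its head.
  fromEnd : A → List A → ℕ → A
  fromEnd d []       n = d
  fromEnd d (x ∷ xs) n with n ℕ.≟ length xs
  ... | yes _ = x
  ... | no  _ = fromEnd d xs n

  module _ {d : A} where

    fromEnd-head : ∀ x xs → fromEnd d (x ∷ xs) (length xs) ≡ x
    fromEnd-head x xs with length xs ℕ.≟ length xs
    ... | yes _ = refl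
    ... | no ≢  = contradiction refl ≢

    fromEnd-tail : ∀ x xs {n} → n < length xs → fromEnd d (x ∷ xs) n ≡ fromEnd d xs n
    fromEnd-tail x xs {n} n< with n ℕ.≟ length xs
    ... | yes refl = contradiction n< (ℕ.<-irrefl refl)
    ... | no _     = refl

    fromEnd-++ : ∀ ys xs {n} → n < length xs → fromEnd d (ys ++ xs) n ≡ fromEnd d xs n
    fromEnd-++ []       xs n< = refl
    fromEnd-++ (y ∷ ys) xs n< =
      trans (fromEnd-tail y (ys ++ xs) (ℕ.<-≤-trans n< xs≤)) (fromEnd-++ ys xs n<)
      where
      xs≤ : length xs ≤ length (ys ++ xs)
      xs≤ = subst (length xs ≤_) (sym (List.length-++ ys)) (ℕ.m≤n+m (length xs) (length ys))

    fromEnd-∈ : ∀ xs {n} → n < length xs → fromEnd d xs n ∈ xs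
    fromEnd-∈ (x ∷ xs) {n} n< with n ℕ.≟ length xs
    ... | yes _ = here refl
    ... | no ≢  = there (fromEnd-∈ xs (ℕ.≤∧≢⇒< (ℕ.s≤s⁻¹ n<) ≢))

    fromEnd-injective : ∀ xs → Unique xs → ∀ {m n} → m < n → n < length xs →
                        fromEnd d xs m ≢ fromEnd d xs n
    fromEnd-injective (x ∷ xs) (x≢ ∷ u) {m} {n} m<n n< eq
      with m ℕ.≟ length xs | n ℕ.≟ length xs
    ... | yes refl | _        = contradiction m<n (ℕ.≤⇒≯ (ℕ.s≤s⁻¹ n<))
    ... | no _     | yes refl = All.lookup x≢ (fromEnd-∈ xs m<n) (sym eq)
    ... | no _     | no ≢     = fromEnd-injective xs u m<n (ℕ.≤∧≢⇒< (ℕ.s≤s⁻¹ n<) ≢) eq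

    fromEnd-linked : ∀ {r} {R : Rel A r} xs → Linked R xs → ∀ {n} → suc n < length xs →
                     R (fromEnd d xs (suc n)) (fromEnd d xs n)
    fromEnd-linked (x ∷ [])     l       (s≤s ())
    fromEnd-linked {R = R} (x ∷ y ∷ xs) (xy ∷ l) {n} n<
      with suc n ℕ.≟ length (y ∷ xs)
    ... | yes refl = subst (R x)
          (sym (trans (fromEnd-tail x (y ∷ xs) ℕ.≤-refl) (fromEnd-head y xs))) xy
    ... | no ≢     = subst (R _) (sym (fromEnd-tail x (y ∷ xs) (ℕ.<-trans ℕ.≤-refl n<′)))
                       (fromEnd-linked (y ∷ xs) l n<′)
      where
      n<′ : suc n < length (y ∷ xs)
      n<′ = ℕ.≤∧≢⇒< (ℕ.s≤s⁻¹ n<) ≢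

module Classical {a ℓ} (em : ExcludedMiddle (a ⊔ ℓ)) where

  decᵃ : (P : Set a) → Dec P
  decᵃ P = map′ lower lift (em {Lift ℓ P})

  decˡ : (P : Set ℓ) → Dec P
  decˡ P = map′ lower lift (em {Lift a P})

  stable : {P : Set (a ⊔ ℓ)} → ¬ ¬ P → P
  stable = decidable-stable em

-- The fuel `d` bounds the number of jumps to a later index satisfying `P`, since all such indices
-- lie below `M`.
last-index : ∀ {a} {P : ℕ → Set a} → (∀ m → Dec (∃[ k ] m < k × P k)) →
             ∀ M → (∀ k → M ≤ k → ¬ P k) → ∀ d m → M ≤ d ℕ.+ m → P m →
             ∃[ n ] m ≤ n × P n × (∀ k → n < k → ¬ P k)
last-index dec M none zero    m M≤ Pm = contradiction Pm (none m M≤)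
last-index dec M none (suc d) m M≤ Pm with dec m
... | no  no-later         = m , ℕ.≤-refl , Pm , λ k m<k Pk → no-later (k , m<k , Pk)
... | yes (k , m<k , Pk) with last-index dec M none d k M≤d+k Pk
  where
  M≤d+k : M ≤ d ℕ.+ k
  M≤d+k = ℕ.≤-trans M≤ (subst (_≤ d ℕ.+ k) (ℕ.+-suc d m) (ℕ.+-monoʳ-≤ d m<k))
... | n , k≤n , Pn , later = n , ℕ.≤-trans (ℕ.<⇒≤ m<k) k≤n , Pn , later

-- Sums of finitely supported integer functions

module _ {a} {A : Set a} where

  sum : (A → ℤ) → List A → ℤ
  sum h []       = 0ℤ
  sum h (x ∷ xs) = h x ℤ.+ sum h xs

  sum-cong : ∀ {h k} → (∀ x → h x ≡ k x) → ∀ xs → sum h xs ≡ sum k xs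
  sum-cong eq []       = refl
  sum-cong eq (x ∷ xs) = cong₂ ℤ._+_ (eq x) (sum-cong eq xs)

  sum-+ : ∀ h k xs → sum (λ x → h x ℤ.+ k x) xs ≡ sum h xs ℤ.+ sum k xs
  sum-+ h k []       = refl
  sum-+ h k (x ∷ xs) rewrite sum-+ h k xs = interchange (h x) (k x) (sum h xs) (sum k xs)
    where
    interchange : ∀ p q r s → p ℤ.+ q ℤ.+ (r ℤ.+ s) ≡ p ℤ.+ r ℤ.+ (q ℤ.+ s)
    interchange = solve-∀

  sum-* : ∀ c h xs → sum (λ x → c ℤ.* h x) xs ≡ c ℤ.* sum h xs
  sum-* c h []       = sym (ℤ.*-zeroʳ c)
  sum-* c h (x ∷ xs) rewrite sum-* c h xs = sym (ℤ.*-distribˡ-+ c (h x) (sum h xs))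

  sum-zero : ∀ {h} xs → (∀ x → x ∈ xs → h x ≡ 0ℤ) → sum h xs ≡ 0ℤ
  sum-zero []       z = refl
  sum-zero (x ∷ xs) z rewrite z x (here refl) | sum-zero xs (λ y → z y ∘ there) = refl

  sum-nonneg : ∀ {h} → (∀ x → 0ℤ ℤ.≤ h x) → ∀ xs → 0ℤ ℤ.≤ sum h xs
  sum-nonneg h≥0 []       = ℤ.≤-refl
  sum-nonneg h≥0 (x ∷ xs) = ℤ.+-mono-≤ (h≥0 x) (sum-nonneg h≥0 xs)

  sum-pos : ∀ {h} → (∀ x → 0ℤ ℤ.≤ h x) → ∀ {x} → 1ℤ ℤ.≤ h x → ∀ {xs} → x ∈ xs → 1ℤ ℤ.≤ sum h xs
  sum-pos h≥0 hx≥1 {y ∷ xs} (here refl) = ℤ.+-mono-≤ hx≥1 (sum-nonneg h≥0 xs)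
  sum-pos h≥0 hx≥1 {y ∷ xs} (there x∈)  = ℤ.+-mono-≤ (h≥0 y) (sum-pos h≥0 hx≥1 x∈)

  sum-mid : ∀ h as x bs → sum h (as ++ x ∷ bs) ≡ h x ℤ.+ sum h (as ++ bs)
  sum-mid h []       x bs = refl
  sum-mid h (b ∷ as) x bs rewrite sum-mid h as x bs = exchange (h b) (h x) (sum h (as ++ bs))
    where
    exchange : ∀ p q r → p ℤ.+ (q ℤ.+ r) ≡ q ℤ.+ (p ℤ.+ r)
    exchange = solve-∀

  unique-mid : ∀ as {x : A} {bs} → Unique (as ++ x ∷ bs) → Unique (as ++ bs) × x ∉ as ++ bs
  unique-mid []       (x≢ ∷ u) = u , uniqueHead (x≢ ∷ u)
  unique-mid (b ∷ as) {x} {bs} (b≢ ∷ u) with unique-mid as u | All.++⁻ as b≢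
  ... | u′ , x∉ | b≢as , b≢x ∷ b≢bs = All.++⁺ b≢as b≢bs ∷ u′ , λ where
    (here x≡b) → b≢x (sym x≡b)
    (there x∈) → x∉ x∈

  -- The entries of `xs` are cancelled from `ys` one at a time; what is left of `ys` contributes
  -- zero.
  sum-⊆ : ∀ {h} xs {ys} → Unique xs → Unique ys → (∀ x → x ∈ xs → x ∈ ys) →
          (∀ y → y ∈ ys → y ∉ xs → h y ≡ 0ℤ) → sum h xs ≡ sum h ys
  sum-⊆ []       {ys} _ _ _ z = sym (sum-zero ys λ y y∈ → z y y∈ λ ())
  sum-⊆ {h} (x ∷ xs) u v xs⊆ys z with ∈-∃++ (xs⊆ys x (here refl))
  ... | as , bs , refl with unique-mid as v
  ...   | v′ , x∉ = trans (cong (ℤ._+_ (h x)) (sum-⊆ xs (AllPairs.tail u) v′ sub z′)) (sym (sum-mid h as x bs))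
    where
    sub : ∀ y → y ∈ xs → y ∈ as ++ bs
    sub y y∈ with ∈-++⁻ as (xs⊆ys y (there y∈))
    ... | inj₁ y∈as         = ∈-++⁺ˡ y∈as
    ... | inj₂ (here refl)  = contradiction y∈ (uniqueHead u)
    ... | inj₂ (there y∈bs) = ∈-++⁺ʳ as y∈bs
    insert : ∀ {y} → y ∈ as ++ bs → y ∈ as ++ x ∷ bs
    insert y∈ = [ ∈-++⁺ˡ , ∈-++⁺ʳ as ∘ there ]′ (∈-++⁻ as y∈)
    z′ : ∀ y → y ∈ as ++ bs → y ∉ xs → h y ≡ 0ℤ
    z′ y y∈ y∉ = z y (insert y∈) λ { (here refl) → x∉ y∈ ; (there y∈xs) → y∉ y∈xs }

  module FiniteSupport (_≟_ : DecidableEquality A) where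

    Supports : (A → ℤ) → List A → Set a
    Supports h xs = ∀ x → h x ≢ 0ℤ → x ∈ xs

    -- Both lists are compared with their deduplicated union, whose further entries lie outside the
    -- support. This makes the sum over the infinite vertex set well defined, so that each identity
    -- may be checked on a list convenient for it.
    sum-support : ∀ {h} xs ys → Unique xs → Unique ys → Supports h xs → Supports h ys →
                  sum h xs ≡ sum h ys
    sum-support {h} xs ys u v p q = trans (to-common u p (λ _ → ∈-++⁺ˡ)) (sym (to-common v q (λ _ → ∈-++⁺ʳ xs)))
      where
      common : List A
      common = deduplicate _≟_ (xs ++ ys)
      to-common : ∀ {zs} → Unique zs → Supports h zs → (∀ z → z ∈ zs → z ∈ xs ++ ys) →
                  sum h zs ≡ sum h common
      to-common {zs} w r sub = sum-⊆ zs w (Unique.deduplicate-! _≟_ (xs ++ ys))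
        (λ z z∈ → ∈-deduplicate⁺ _≟_ (sub z z∈))
        (λ y _ y∉ → decidable-stable (h y ℤ.≟ 0ℤ) (y∉ ∘ r y))

-- Walks inside a set of vertices

module Walks {a ℓ} (D : Digraph a ℓ) where

  open Digraph D renaming (Vertex to V; Adjacent to Adj)

  adj-sym : ∀ {u v} → Adj u v → Adj v u
  adj-sym = symmetric _⟶_

  data Reach {p} (P : V → Set p) : V → V → Set (a ⊔ ℓ ⊔ p) where
    stop : ∀ {u} → P u → Reach P u u
    step : ∀ {u v w} → P u → Adj u v → Reach P v w → Reach P u w

  module _ {p} {P : V → Set p} where

    reach-start : ∀ {u v} → Reach P u v → P u
    reach-start (stop p)     = p
    reach-start (step p _ _) = p

    reach-trans : ∀ {u v w} → Reach P u v → Reach P v w → Reach P u w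
    reach-trans (stop _)     s = s
    reach-trans (step p e r) s = step p e (reach-trans r s)

    reach-sym : ∀ {u v} → Reach P u v → Reach P v u
    reach-sym (stop p)     = stop p
    reach-sym (step p e r) =
      reach-trans (reach-sym r) (step (reach-start r) (adj-sym e) (stop p))

    reach-map : ∀ {q} {Q : V → Set q} → (∀ {x} → P x → Q x) → ∀ {u v} → Reach P u v → Reach Q u v
    reach-map f (stop p)     = stop (f p)
    reach-map f (step p e r) = step (f p) e (reach-map f r)

  module _ {t : ℕ → V} (t-adj : ∀ n → Adj (t n) (t (suc n))) {p} {P : V → Set p}
           {N : ℕ} (P-tail : ∀ n → N ≤ n → P (t n)) where

    reach-tail′ : ∀ {m} → N ≤ m → ∀ k → Reach P (t m) (t (k ℕ.+ m))
    reach-tail′ {m} N≤m zero    = stop (P-tail _ N≤m)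
    reach-tail′ {m} N≤m (suc k) = reach-trans (reach-tail′ N≤m k)
      (step (P-tail _ N≤k) (t-adj _) (stop (P-tail _ (ℕ.≤-trans N≤k (ℕ.n≤1+n _)))))
      where
      N≤k : N ≤ k ℕ.+ m
      N≤k = ℕ.≤-trans N≤m (ℕ.m≤n+m m k)

    reach-tail : ∀ {m n} → N ≤ m → N ≤ n → Reach P (t m) (t n)
    reach-tail {m} {n} N≤m N≤n with ℕ.≤-total m n
    ... | inj₁ m≤n = subst (λ k → Reach P (t m) (t k)) (ℕ.m∸n+n≡m m≤n) (reach-tail′ N≤m (n ℕ.∸ m))
    ... | inj₂ n≤m = reach-sym
          (subst (λ k → Reach P (t n) (t k)) (ℕ.m∸n+n≡m n≤m) (reach-tail′ N≤n (m ℕ.∸ n)))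

-- Automorphisms and their action on rays

module Symmetry {a ℓ} (D : Digraph a ℓ) where

  open Digraph D renaming (Vertex to V; Adjacent to Adj)

  Aut : Set (a ⊔ ℓ)
  Aut = Automorphism D

  infixr 20 _·_
  _·_ : Aut → V → V
  g · v = _≅_.to g v

  infix 25 _⁻¹
  _⁻¹ : Aut → Aut
  g ⁻¹ = record
    { bijection = mk↔ₛ′ G.from G.to G.strictlyInverseʳ G.strictlyInverseˡ
    ; arcs = λ u v → mk⇔
        (λ e → Equivalence.from (_≅_.arcs g _ _)
          (subst₂ _⟶_ (sym (G.strictlyInverseˡ u)) (sym (G.strictlyInverseˡ v)) e))
        (λ e → subst₂ _⟶_ (G.strictlyInverseˡ u) (G.strictlyInverseˡ v)
          (Equivalence.to (_≅_.arcs g _ _) e))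
    }
    where module G = Inverse (_≅_.bijection g)

  infixr 15 _∙_
  _∙_ : Aut → Aut → Aut
  g ∙ h = record
    { bijection = mk↔ₛ′ (G.to ∘ H.to) (H.from ∘ G.from)
        (λ v → trans (cong G.to (H.strictlyInverseˡ _)) (G.strictlyInverseˡ v))
        (λ v → trans (cong H.from (G.strictlyInverseʳ _)) (H.strictlyInverseʳ v))
    ; arcs = λ u v → mk⇔
        (Equivalence.to (_≅_.arcs g _ _) ∘ Equivalence.to (_≅_.arcs h u v))
        (Equivalence.from (_≅_.arcs h u v) ∘ Equivalence.from (_≅_.arcs g _ _))
    }
    where
    module G = Inverse (_≅_.bijection g)
    module H = Inverse (_≅_.bijection h)

  idAut : Aut
  idAut = record { bijection = mk↔ₛ′ id id (λ _ → refl) (λ _ → refl) ; arcs = λ u v → mk⇔ id id }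

  module _ (g : Aut) where

    ·-inverseˡ : ∀ v → g ⁻¹ · g · v ≡ v
    ·-inverseˡ = Inverse.strictlyInverseʳ (_≅_.bijection g)

    ·-inverseʳ : ∀ v → g · g ⁻¹ · v ≡ v
    ·-inverseʳ = Inverse.strictlyInverseˡ (_≅_.bijection g)

    ·-injective : ∀ {u v} → g · u ≡ g · v → u ≡ v
    ·-injective {u} {v} eq = trans (sym (·-inverseˡ u)) (trans (cong (g ⁻¹ ·_) eq) (·-inverseˡ v))

    ·-arc : ∀ {u v} → u ⟶ v → g · u ⟶ g · v
    ·-arc = Equivalence.to (_≅_.arcs g _ _)

    ·-adj : ∀ {u v} → Adj u v → Adj (g · u) (g · v)
    ·-adj (fwd e) = fwd (·-arc e)
    ·-adj (bwd e) = bwd (·-arc e)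

    image : Ray D → Ray D
    image t = record
      { at = λ n → g · Ray.at t n
      ; distinct = Ray.distinct t ∘ ·-injective
      ; adjacent = λ n → ·-adj (Ray.adjacent t n)
      }

-- Rays and ends

module TwoEnds {a ℓ} (em : ExcludedMiddle (a ⊔ ℓ)) (D : Digraph a ℓ)
               (connected : Connected D) (locallyFinite : LocallyFinite D) where

  open Classical {a} {ℓ} em public
  open Digraph D public renaming (Vertex to V; Adjacent to Adj)
  open Walks D public
  open Symmetry D public

  infix 4 _≟_
  _≟_ : DecidableEquality V
  u ≟ v = decᵃ (u ≡ v)

  nbrs : V → List V
  nbrs u = proj₁ (proj₁ (locallyFinite u)) ++ proj₁ (proj₂ (locallyFinite u))

  adj⇒∈nbrs : ∀ {u v} → Adj u v → v ∈ nbrs u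
  adj⇒∈nbrs {u} {v} (fwd e) =
    ∈-++⁺ˡ (Equivalence.to (proj₂ (proj₁ (locallyFinite u)) v) e)
  adj⇒∈nbrs {u} {v} (bwd e) =
    ∈-++⁺ʳ _ (Equivalence.to (proj₂ (proj₂ (locallyFinite u)) v) e)

  ∈nbrs⇒adj : ∀ {u v} → v ∈ nbrs u → Adj u v
  ∈nbrs⇒adj {u} {v} v∈ with ∈-++⁻ (proj₁ (proj₁ (locallyFinite u))) v∈
  ... | inj₁ v∈out = fwd (Equivalence.from (proj₂ (proj₁ (locallyFinite u)) v) v∈out)
  ... | inj₂ v∈in  = bwd (Equivalence.from (proj₂ (proj₂ (locallyFinite u)) v) v∈in)

  -- By `distinct`, each listed vertex is visited at most once, so some position is past all of
  -- these visits.
  eventually-avoids : (t : Ray D) (l : List V) → ∃[ N ] (∀ n → N ≤ n → Ray.at t n ∉ l)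
  eventually-avoids t []      = 0 , λ _ _ ()
  eventually-avoids t (x ∷ l) with eventually-avoids t l | decᵃ (Lift a (∃[ n ] Ray.at t n ≡ x))
  ... | N , avoid | no never = N , λ where
    n N≤n (here eq)   → never (lift (n , eq))
    n N≤n (there ∈l) → avoid n N≤n ∈l
  ... | N , avoid | yes (lift (m , tm≡x)) = suc m ℕ.⊔ N , λ where
    n ≤n (here eq)   → ℕ.<-irrefl (Ray.distinct t (trans tm≡x (sym eq))) (ℕ.m⊔n≤o⇒m≤o (suc m) N ≤n)
    n ≤n (there ∈l) → avoid n (ℕ.m⊔n≤o⇒n≤o (suc m) N ≤n) ∈l

  -- Finite paths, each extending the previous one at its head; their limit is `ray`. Both König's
  -- lemma and the joining of two rays construct their rays in this form.
  record Grows : Set (a ⊔ ℓ) where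
    field
      hd      : ℕ → V
      tl      : ℕ → List V
      linked  : ∀ i → Linked Adj (hd i ∷ tl i)
      unique  : ∀ i → Unique (hd i ∷ tl i)
      grow    : ∀ i → ∃[ y ] ∃[ ys ] hd (suc i) ∷ tl (suc i) ≡ (y ∷ ys) ++ hd i ∷ tl i

    path : ℕ → List V
    path i = hd i ∷ tl i

    prefix : ∀ i k → ∃[ ys ] path (k ℕ.+ i) ≡ ys ++ path i
    prefix i zero    = [] , refl
    prefix i (suc k) with prefix i k | grow (k ℕ.+ i)
    ... | ys , eq | z , zs , eq′ =
      (z ∷ zs) ++ ys , trans eq′ (trans (cong ((z ∷ zs) ++_) eq) (sym (List.++-assoc (z ∷ zs) ys _)))

    i<length : ∀ i → i < length (path i)
    i<length zero    = s≤s z≤n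
    i<length (suc i) with grow i
    ... | z , zs , eq = subst (suc i <_) (sym (cong length eq))
      (s≤s (subst (i <_) (sym (List.length-++ zs))
        (ℕ.<-≤-trans (i<length i) (ℕ.m≤n+m _ (length zs)))))

    -- The default `hd 0` is never returned, because `path n` has more than `n` vertices.
    element : ℕ → V
    element n = fromEnd (hd 0) (path n) n

    element-path : ∀ {n} i → n < length (path i) → element n ≡ fromEnd (hd 0) (path i) n
    element-path {n} i n< with ℕ.≤-total n i
    ... | inj₁ n≤i with i ℕ.∸ n | ℕ.m∸n+n≡m n≤i
    ...   | k | refl with prefix n k
    ...     | ys , eq = sym (trans (cong (λ l → fromEnd _ l n) eq)
                              (fromEnd-++ ys (path n) (i<length n)))
    element-path {n} i n< | inj₂ i≤n with n ℕ.∸ i | ℕ.m∸n+n≡m i≤n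
    ...   | k | refl with prefix i k
    ...     | ys , eq = trans (cong (λ l → fromEnd _ l n) eq) (fromEnd-++ ys (path i) n<)

    ray : Ray D
    ray = record
      { at       = element
      ; distinct = λ {m} {n} eq → distinct m n eq
      ; adjacent = λ n → subst₂ Adj
          (sym (element-path (suc n) (ℕ.<-trans ℕ.≤-refl (i<length (suc n)))))
          (sym (element-path (suc n) (i<length (suc n))))
          (adj-sym (fromEnd-linked (path (suc n)) (linked (suc n)) (i<length (suc n))))
      }
      where
      ordered : ∀ m n → m < n → element m ≢ element n
      ordered m n m<n eq = fromEnd-injective (path n) (unique n) m<n (i<length n)
        (trans (sym (element-path n (ℕ.<-trans m<n (i<length n)))) eq)
      distinct : ∀ m n → element m ≡ element n → m ≡ n
      distinct m n eq with ℕ.<-cmp m n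
      ... | tri< m<n _ _ = contradiction eq (ordered m n m<n)
      ... | tri≈ _ m≡n _ = m≡n
      ... | tri> _ _ n<m = contradiction (sym eq) (ordered n m n<m)

    element-∈ : ∀ n → element n ∈ path n
    element-∈ n = fromEnd-∈ (path n) (i<length n)

    visits-hd : ∀ i → ∃[ n ] i ≤ n × element n ≡ hd i
    visits-hd i = length (tl i) , ℕ.s≤s⁻¹ (i<length i) ,
      trans (element-path i ℕ.≤-refl) (fromEnd-head (hd i) (tl i))

  Avoiding : (V → Set (a ⊔ ℓ)) → List V → V → Set (a ⊔ ℓ)
  Avoiding U t x = U x × x ∉ t

  module _ {U : V → Set (a ⊔ ℓ)} where

    -- The walk is cut at its last visit to `u`, if there is one; what follows starts at a neighbour
    -- of `u`.
    last-exit : ∀ {t u x w} → Reach (Avoiding U t) x w →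
                Reach (Avoiding U (u ∷ t)) x w ⊎
                (w ≡ u ⊎ ∃[ v ] v ∈ nbrs u × Reach (Avoiding U (u ∷ t)) v w)
    last-exit {u = u} (stop {x} (Ux , x∉t)) with x ≟ u
    ... | yes x≡u = inj₂ (inj₁ x≡u)
    ... | no  x≢u = inj₁ (stop (Ux , λ { (here x≡u) → x≢u x≡u ; (there x∈t) → x∉t x∈t }))
    last-exit {u = u} (step {x} (Ux , x∉t) e r) with last-exit {u = u} r
    ... | inj₂ done = inj₂ done
    ... | inj₁ r′ with x ≟ u
    ...   | yes refl = inj₂ (inj₂ (_ , adj⇒∈nbrs e , r′))
    ...   | no  x≢u  = inj₁ (step (Ux , λ { (here x≡u) → x≢u x≡u ; (there x∈t) → x∉t x∈t }) e r′)

    infinite-start : ∀ {P : V → Set (a ⊔ ℓ)} {v} → ¬ Listed (Reach P v) → P v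
    infinite-start inf = stable λ ¬Pv → inf ([] , λ w r → ⊥-elim (¬Pv (reach-start r)))

    -- Otherwise each of the finitely many neighbours of `u` would reach only finitely many vertices
    -- off `u ∷ t`, and by `last-exit` these together with `u` are all that `u` reaches off `t`.
    advance : ∀ {t u} → ¬ Listed (Reach (Avoiding U t) u) →
              ∃[ v ] Adj u v × ¬ Listed (Reach (Avoiding U (u ∷ t)) v)
    advance {t} {u} inf = stable λ none →
      inf (listed-⊆ cover
        (listed-∪ ([ u ] , λ w → here)
          (listed-⋃ (nbrs u) λ v v∈ → stable λ infᵥ → none (v , ∈nbrs⇒adj v∈ , infᵥ))))
      where
      cover : ∀ w → Reach (Avoiding U t) u w →
              w ≡ u ⊎ ∃[ v ] v ∈ nbrs u × Reach (Avoiding U (u ∷ t)) v w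
      cover w r with last-exit {u = u} r
      ... | inj₂ c = c
      ... | inj₁ r′ = ⊥-elim (proj₂ (reach-start r′) (here refl))

    record Stage : Set (a ⊔ ℓ) where
      field
        hd      : V
        tl      : List V
        linked  : Linked Adj (hd ∷ tl)
        unique  : Unique (hd ∷ tl)
        inside  : All U (hd ∷ tl)
        ongoing : ¬ Listed (Reach (Avoiding U tl) hd)

    next : Stage → Stage
    next S with advance (Stage.ongoing S)
    ... | v , e , inf = record
      { hd = v ; tl = S.hd ∷ S.tl
      ; linked = adj-sym e ∷ S.linked
      ; unique = consUnique (proj₂ (infinite-start inf)) S.unique
      ; inside = proj₁ (infinite-start inf) ∷ S.inside
      ; ongoing = inf
      }
      where module S = Stage S

    module _ {u} (inf : ¬ Listed (Reach U u)) where

      stage : ℕ → Stage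
      stage zero = record
        { hd = u ; tl = [] ; linked = [-] ; unique = [] ∷ []
        ; inside = infinite-start inf ∷ []
        ; ongoing = inf ∘ listed-⊆ (λ w → reach-map (λ Ux → Ux , λ ()))
        }
      stage (suc i) = next (stage i)

      grows : Grows
      grows = record
        { hd = λ i → Stage.hd (stage i)
        ; tl = λ i → Stage.tl (stage i)
        ; linked = λ i → Stage.linked (stage i)
        ; unique = λ i → Stage.unique (stage i)
        ; grow = λ i → _ , [] , refl
        }

      -- König's lemma for an infinite component of `U`.
      könig : Σ[ t ∈ Ray D ] (∀ n → U (Ray.at t n))
      könig = Grows.ray grows , λ n → All.lookup (Stage.inside (stage n)) (Grows.element-∈ grows n)

  -- Side t P v: the vertex v lies in the component of P that contains a tail of t.
  Side : ∀ {p} → (ℕ → V) → (V → Set p) → V → Set (a ⊔ ℓ ⊔ p)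
  Side t P v = ∃[ N ] (∀ n → N ≤ n → Reach P v (t n))

  EventuallyOutside : Ray D → (V → Set (a ⊔ ℓ)) → Set (a ⊔ ℓ)
  EventuallyOutside t U = ∃[ N ] (∀ n → N ≤ n → ¬ U (Ray.at t n))

  module _ {U : V → Set (a ⊔ ℓ)} (F : List V)
           (boundary : ∀ {x y} → U x → Adj x y → ¬ U y → y ∈ F) where

    -- The last vertex before the walk first leaves `U` is a neighbour of `F`. Hence each component
    -- of `U` from which a walk leads out meets a fixed finite list, and there are only finitely
    -- many such components.
    first-exit : ∀ {u w} → Star Adj u w → U u → ¬ U w →
                 ∃[ q ] q ∈ concatMap nbrs F × Reach U q u
    first-exit ε Uu ¬Uw = contradiction Uu ¬Uw
    first-exit (_◅_ {j = v} e es) Uu ¬Uw with em {U v}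
    ... | no ¬Uv = _ , ∈-concatMap⁺ nbrs (Any.map (λ { refl → adj⇒∈nbrs (adj-sym e) }) (boundary Uu e ¬Uv)) , stop Uu
    ... | yes Uv with first-exit es Uv ¬Uw
    ...   | q , q∈ , r = q , q∈ , reach-trans r (step Uv (adj-sym e) (stop Uu))

    -- Once the third ray `q` is past `F`, it meets `t` inside `U` and can no longer leave `U`; yet
    -- it must still meet `r` at places outside `U`.
    ray-trapped : ∀ {t r : Ray D} → (∀ n → U (Ray.at t n)) → RayEquivalent t r →
                  EventuallyOutside r U → ⊥
    ray-trapped {t} {r} t⊆U (q , q∩t , q∩r) (N , out)
      -- Infinitely many meetings are late on `q` by definition; avoiding the first `N` vertices of
      -- `r` makes them late on `r` too.
      with eventually-avoids q (F ++ applyUpTo (Ray.at r) N)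
    ... | M , avoid with q∩t M
    ...   | n , M≤n , k , qn≡tk with q∩r n
    ...     | n′ , n≤n′ , k′ , qn′≡rk′ with k′ ℕ.<? N
    ...       | yes k′<N = avoid n′ (ℕ.≤-trans M≤n n≤n′)
                  (∈-++⁺ʳ F (subst (_∈ _) (sym qn′≡rk′) (∈-applyUpTo⁺ (Ray.at r) k′<N)))
    ...       | no  k′≮N = out k′ (ℕ.≮⇒≥ k′≮N) (subst U qn′≡rk′ (subst (U ∘ Ray.at q) (ℕ.m∸n+n≡m n≤n′) (stays (n′ ℕ.∸ n))))
      where
      stays : ∀ j → U (Ray.at q (j ℕ.+ n))
      stays zero    = subst U (sym qn≡tk) (t⊆U k)
      stays (suc j) = stable λ ¬U → avoid (suc j ℕ.+ n) (ℕ.≤-trans M≤n (ℕ.m≤n+m n (suc j)))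
        (∈-++⁺ˡ (boundary (stays j) (Ray.adjacent q (j ℕ.+ n)) ¬U))

    -- An infinite `U` would have an infinite component, since finitely many components cover it. By
    -- König's lemma that component contains a ray, which by `ray-trapped` belongs to neither end.
    finite-if-endless : ∀ {r s : Ray D} → (∀ t → RayEquivalent t r ⊎ RayEquivalent t s) →
                        EventuallyOutside r U → EventuallyOutside s U → Listed U
    finite-if-endless {r} {s} two r-out s-out = stable λ inf →
      inf (listed-⊆ cover (listed-⋃ (concatMap nbrs F) λ q q∈ → stable λ inf′ → absurd (könig inf′)))
      where
      cover : ∀ u → U u → ∃[ q ] q ∈ concatMap nbrs F × Reach U q u
      cover u Uu = first-exit (connected u (Ray.at r (proj₁ r-out))) Uu (proj₂ r-out _ ℕ.≤-refl)
      absurd : Σ[ t ∈ Ray D ] (∀ n → U (Ray.at t n)) → ⊥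
      absurd (t , t⊆U) with two t
      ... | inj₁ t~r = ray-trapped {t} {r} t⊆U t~r r-out
      ... | inj₂ t~s = ray-trapped {t} {s} t⊆U t~s s-out

  -- The walk is followed step by step; when it returns to the new part `v ∷ q`, the path is cut
  -- back to that vertex. The walk avoids `B`, so the old part stays intact.
  loop-erase : ∀ {B : List V} {v w} q → Linked Adj ((v ∷ q) ++ B) → Unique ((v ∷ q) ++ B) →
               Reach (_∉ B) v w → ∃[ q′ ] Linked Adj ((w ∷ q′) ++ B) × Unique ((w ∷ q′) ++ B)
  loop-erase q lk un (stop _) = q , lk , un
  loop-erase {B} {v} q lk un (step {v = v′} _ e r) with decᵃ (v′ ∈ v ∷ q)
  ... | yes v′∈ with ∈-∃++ v′∈
  ...   | q₁ , q₂ , eq = loop-erase q₂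
          (dropLinked q₁ (subst (Linked Adj) eq′ lk)) (dropUnique q₁ (subst Unique eq′ un)) r
    where
    eq′ : (v ∷ q) ++ B ≡ q₁ ++ (v′ ∷ q₂) ++ B
    eq′ = trans (cong (_++ B) eq) (List.++-assoc q₁ (v′ ∷ q₂) B)
  loop-erase {B} {v} q lk un (step {v = v′} _ e r) | no v′∉ =
    loop-erase (v ∷ q) (adj-sym e ∷ lk)
      (consUnique (λ v′∈ → [ v′∉ , reach-start r ]′ (∈-++⁻ (v ∷ q) v′∈)) un) r

  Separates : Ray D → Ray D → List V → Set (a ⊔ ℓ)
  Separates r s F = ∀ v → Side (Ray.at r) (_∉ F) v → Side (Ray.at s) (_∉ F) v → ⊥

  -- A path ending on x that the rest of x avoids; extending such paths
  -- alternately for two rays that no finite set separates gives a ray that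
  -- meets both infinitely often.
  record Tip (x : Ray D) : Set (a ⊔ ℓ) where
    field
      index  : ℕ
      tl     : List V
    hd : V
    hd = Ray.at x index
    field
      linked : Linked Adj (hd ∷ tl)
      unique : Unique (hd ∷ tl)
      free   : ∀ k → index < k → Ray.at x k ∉ hd ∷ tl

  module _ {x y : Ray D} (joined : ∀ F → ∃[ v ] Side (Ray.at x) (_∉ F) v × Side (Ray.at y) (_∉ F) v)
           (T : Tip x) where
    private
      module T = Tip T
      B : List V
      B = T.hd ∷ T.tl

    -- The next vertex of `x` is connected off `B` to the tail of `x` because the tip is free, and
    -- the vertex given by `joined` connects that tail to the tail of `y`.
    crossing : ∃[ m ] (∀ k → m ≤ k → Ray.at y k ∉ B) × Reach (_∉ B) (Ray.at x (suc T.index)) (Ray.at y m)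
    crossing with joined B | eventually-avoids y B
    ... | v , (N₁ , to-x) , (N₂ , to-y) | N , avoid =
      N ℕ.⊔ N₂ , (λ k ≤k → avoid k (ℕ.m⊔n≤o⇒m≤o N N₂ ≤k)) ,
      reach-trans (reach-tail (Ray.adjacent x) T.free ℕ.≤-refl (ℕ.m≤m⊔n (suc T.index) N₁))
        (reach-trans (reach-sym (to-x _ (ℕ.m≤n⊔m (suc T.index) N₁))) (to-y _ (ℕ.m≤n⊔m N N₂)))

    abstract
      cross : Σ[ T′ ∈ Tip y ] (∃[ z ] ∃[ zs ] Tip.hd T′ ∷ Tip.tl T′ ≡ (z ∷ zs) ++ T.hd ∷ T.tl)
      cross with crossing
      ... | m , y∉B , r with loop-erase [] (adj-sym (Ray.adjacent x T.index) ∷ T.linked)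
                               (consUnique (reach-start r) T.unique) r
      ...   | q , lk , un with eventually-avoids y ((Ray.at y m ∷ q) ++ B)
      -- The new path is cut at the last vertex of `y` on it, which makes the rest of `y` free.
      -- Since its index is at least `m`, this vertex is not in `B`, so the old path survives the
      -- cut.
      ...     | M , avoid with last-index {P = λ k → Ray.at y k ∈ (Ray.at y m ∷ q) ++ B}
                                 (λ _ → decᵃ _) M (λ k M≤k → avoid k M≤k) M m (ℕ.m≤m+n M m) (here refl)
      ...       | n , m≤n , yn∈ , later with ∈-++⁻ (Ray.at y m ∷ q) yn∈
      ...         | inj₂ yn∈B = contradiction yn∈B (y∉B n m≤n)
      ...         | inj₁ yn∈q with ∈-∃++ yn∈q
      ...           | q₁ , q₂ , eq = record
                      { index = n ; tl = q₂ ++ B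
                      ; linked = dropLinked q₁ (subst (Linked Adj) eq′ lk)
                      ; unique = dropUnique q₁ (subst Unique eq′ un)
                      ; free = λ k n<k yk∈ → later k n<k (subst (_ ∈_) (sym eq′) (∈-++⁺ʳ q₁ yk∈))
                      } , _ , q₂ , refl
        where
        eq′ : (Ray.at y m ∷ q) ++ B ≡ q₁ ++ (Ray.at y n ∷ q₂) ++ B
        eq′ = trans (cong (_++ B) eq) (List.++-assoc q₁ (Ray.at y n ∷ q₂) B)

  module _ (r s : Ray D) (joined : ∀ F → ∃[ v ] Side (Ray.at r) (_∉ F) v × Side (Ray.at s) (_∉ F) v) where
    private
      ray : Bool → Ray D
      ray true  = r
      ray false = s

      joined′ : ∀ b F → ∃[ v ] Side (Ray.at (ray b)) (_∉ F) v × Side (Ray.at (ray (not b))) (_∉ F) v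
      joined′ true  F = joined F
      joined′ false F with joined F
      ... | v , p , q = v , q , p

      parity : ℕ → Bool
      parity zero    = true
      parity (suc n) = not (parity n)

      tip : ∀ n → Tip (ray (parity n))
      tip zero = record
        { index = 0 ; tl = [] ; linked = [-] ; unique = [] ∷ []
        ; free = λ { k 0<k (here eq) → ℕ.<-irrefl (sym (Ray.distinct r eq)) 0<k } }
      tip (suc n) = proj₁ (cross (joined′ (parity n)) (tip n))

      alternating : Grows
      alternating = record
        { hd = λ i → Tip.hd (tip i)
        ; tl = λ i → Tip.tl (tip i)
        ; linked = λ i → Tip.linked (tip i)
        ; unique = λ i → Tip.unique (tip i)
        ; grow = λ i → proj₂ (cross (joined′ (parity i)) (tip i))
        }

      parity-later : ∀ b m → ∃[ i ] m ≤ i × parity i ≡ b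
      parity-later true m with parity m in eq
      ... | true  = m , ℕ.≤-refl , eq
      ... | false = suc m , ℕ.n≤1+n m , cong not eq
      parity-later false m with parity m in eq
      ... | false = m , ℕ.≤-refl , eq
      ... | true  = suc m , ℕ.n≤1+n m , cong not eq

      meets : ∀ b → MeetsInfinitelyOften (Grows.ray alternating) (ray b)
      meets b m with parity-later b m
      ... | i , m≤i , refl with Grows.visits-hd alternating i
      ...   | n , i≤n , eq = n , ℕ.≤-trans m≤i i≤n , Tip.index (tip i) , eq

    joined⇒equivalent : RayEquivalent r s
    joined⇒equivalent = Grows.ray alternating , meets true , meets false

  -- If every finite set failed to separate the rays, the alternating ray would make them
  -- equivalent. From here on, ends are used through finite separators.
  separator : ∀ {r s} → ¬ RayEquivalent r s → ∃ (Separates r s)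
  separator {r} {s} r≁s = stable λ none → r≁s (joined⇒equivalent r s λ F → stable λ ¬v →
    none (F , λ v p q → ¬v (v , p , q)))

  -- The third ray `q`, once past `F`, links a late vertex of `t` to a late vertex of `u` within
  -- `P`.
  side-transfer : ∀ {p} {P : V → Set p} {t u : Ray D} {F : List V} → (∀ {x} → x ∉ F → P x) →
                  RayEquivalent t u → ∀ {v} → Side (Ray.at t) P v → Side (Ray.at u) P v
  side-transfer {P = P} {t} {u} {F} off (q , q∩t , q∩u) {v} (N , to-t)
    with eventually-avoids q (F ++ applyUpTo (Ray.at t) N) | eventually-avoids u F
  ... | M , q-avoid | M′ , u-avoid with q∩t M | eventually-avoids q (applyUpTo (Ray.at u) M′)
  ...   | n , M≤n , k , qn≡tk | M″ , q-avoid′ with q∩u (n ℕ.⊔ M″)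
  ...     | n′ , ≤n′ , k′ , qn′≡uk′ = k′ ℕ.⊔ M′ , λ j ≤j →
            reach-trans (to-t k k≥N) (reach-trans
              (subst₂ (Reach P) qn≡tk qn′≡uk′ (reach-tail (Ray.adjacent q) q-tail M≤n
                 (ℕ.≤-trans M≤n (ℕ.m⊔n≤o⇒m≤o n M″ ≤n′))))
              (reach-tail (Ray.adjacent u) (λ i M′≤i → off (u-avoid i M′≤i)) k′≥M′
                 (ℕ.m⊔n≤o⇒n≤o k′ M′ ≤j)))
    where
    q-tail : ∀ i → M ≤ i → P (Ray.at q i)
    q-tail i M≤i = off (q-avoid i M≤i ∘ ∈-++⁺ˡ)
    k≥N : N ≤ k
    k≥N = ℕ.≮⇒≥ λ k<N → q-avoid n M≤n
      (∈-++⁺ʳ F (subst (_∈ _) (sym qn≡tk) (∈-applyUpTo⁺ (Ray.at t) k<N)))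
    k′≥M′ : M′ ≤ k′
    k′≥M′ = ℕ.≮⇒≥ λ k′<M′ → q-avoid′ n′ (ℕ.m⊔n≤o⇒n≤o n M″ ≤n′)
      (subst (_∈ _) (sym qn′≡uk′) (∈-applyUpTo⁺ (Ray.at u) k′<M′))

  -- The level function of a two-ended vertex-transitive digraph

  module Heights (r s : Ray D) (r≁s : ¬ RayEquivalent r s)
                 (two : ∀ (t : Ray D) → RayEquivalent t r ⊎ RayEquivalent t s)
                 (transitive : ∀ u v → Σ[ g ∈ Automorphism D ] _≅_.to g u ≡ v) where

    open FiniteSupport _≟_

    ball : ℕ → V → List V
    ball zero    x = [ x ]
    ball (suc n) x = ball n x ++ concatMap nbrs (ball n x)

    ball-step : ∀ n {x y z} → y ∈ ball n x → Adj y z → z ∈ ball (suc n) x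
    ball-step n {x} y∈ e = ∈-++⁺ʳ (ball n x)
      (∈-concatMap⁺ nbrs (Any.map (λ { refl → adj⇒∈nbrs e }) y∈))

    ball-step⁻ : ∀ n {x z} → z ∈ ball (suc n) x → z ∈ ball n x ⊎ ∃[ y ] y ∈ ball n x × Adj y z
    ball-step⁻ n {x} z∈ with ∈-++⁻ (ball n x) z∈
    ... | inj₁ z∈′ = inj₁ z∈′
    ... | inj₂ z∈′ with find (∈-concatMap⁻ nbrs {xs = ball n x} z∈′)
    ...   | y , y∈ , z∈nbrs = inj₂ (y , y∈ , ∈nbrs⇒adj z∈nbrs)

    ball-mono : ∀ {m n} → m ≤ n → ∀ {x y} → y ∈ ball m x → y ∈ ball n x
    ball-mono {m} {n} m≤n {x} {y} y∈ = subst (λ k → y ∈ ball k x) (ℕ.m∸n+n≡m m≤n) (go (n ℕ.∸ m))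
      where
      go : ∀ k → y ∈ ball (k ℕ.+ m) x
      go zero    = y∈
      go (suc k) = ∈-++⁺ˡ (go k)

    ball-centre : ∀ n x → x ∈ ball n x
    ball-centre n x = ball-mono {0} {n} z≤n (here refl)

    ball-stepˡ : ∀ n {x y z} → Adj x y → z ∈ ball n y → z ∈ ball (suc n) x
    ball-stepˡ zero    e (here refl) = ball-step 0 (here refl) e
    ball-stepˡ (suc n) e z∈ with ball-step⁻ n z∈
    ... | inj₁ z∈′           = ∈-++⁺ˡ (ball-stepˡ n e z∈′)
    ... | inj₂ (w , w∈ , e′) = ball-step (suc n) (ball-stepˡ n e w∈) e′

    ball-sym : ∀ n {x y} → y ∈ ball n x → x ∈ ball n y
    ball-sym zero    (here refl) = here refl
    ball-sym (suc n) y∈ with ball-step⁻ n y∈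
    ... | inj₁ y∈′          = ∈-++⁺ˡ (ball-sym n y∈′)
    ... | inj₂ (w , w∈ , e) = ball-stepˡ n (adj-sym e) (ball-sym n w∈)

    ball-image : ∀ g n {x y} → y ∈ ball n x → g · y ∈ ball n (g · x)
    ball-image g zero    (here refl) = here refl
    ball-image g (suc n) y∈ with ball-step⁻ n y∈
    ... | inj₁ y∈′          = ∈-++⁺ˡ (ball-image g n y∈′)
    ... | inj₂ (w , w∈ , e) = ball-step n (ball-image g n w∈) (·-adj g e)

    ball-reach : ∀ n {x y} → y ∈ ball n x → Reach (_∈ ball n x) y x
    ball-reach zero    (here refl) = stop (here refl)
    ball-reach (suc n) y∈ with ball-step⁻ n y∈
    ... | inj₁ y∈′          = reach-map ∈-++⁺ˡ (ball-reach n y∈′)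
    ... | inj₂ (w , w∈ , e) = step y∈ (adj-sym e) (reach-map ∈-++⁺ˡ (ball-reach n w∈))

    in-some-ball : ∀ {x y} → Star Adj x y → ∃[ n ] y ∈ ball n x
    in-some-ball ε        = 0 , here refl
    in-some-ball (e ◅ es) with in-some-ball es
    ... | n , y∈ = suc n , ball-stepˡ n e y∈

    ball-covers : ∀ x (F : List V) → ∃[ n ] (∀ y → y ∈ F → y ∈ ball n x)
    ball-covers x []      = 0 , λ _ ()
    ball-covers x (y ∷ F) with in-some-ball (connected x y) | ball-covers x F
    ... | m , y∈ | n , F⊆ = m ℕ.⊔ n , λ where
      _ (here refl) → ball-mono (ℕ.m≤m⊔n m n) y∈
      z (there z∈F) → ball-mono (ℕ.m≤n⊔m m n) (F⊆ z z∈F)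

    o : V
    o = Ray.at r 0

    abstract
      -- Chosen so that the ball around `o` contains a separator; `separated` shows that it serves
      -- at every vertex.
      radius : ℕ
      radius = proj₁ (ball-covers o (proj₁ (separator {r} {s} r≁s)))

      separator⊆ball : ∀ y → y ∈ proj₁ (separator {r} {s} r≁s) → y ∈ ball radius o
      separator⊆ball = proj₂ (ball-covers o (proj₁ (separator {r} {s} r≁s)))

    Off : V → V → Set a
    Off x y = y ∉ ball radius x

    -- For the rays `r` and `s` these are the sides R x and L x of the ball around `x`.
    Toward : Ray D → V → V → Set (a ⊔ ℓ)
    Toward t x v = Side (Ray.at t) (Off x) v

    off-image : ∀ g {x y} → Off x y → Off (g · x) (g · y)
    off-image g {x} {y} off gy∈ = off
      (subst₂ (λ p q → p ∈ ball radius q) (·-inverseˡ g y) (·-inverseˡ g x)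
        (ball-image (g ⁻¹) radius gy∈))

    reach-image : ∀ {p q} {P : V → Set p} {Q : V → Set q} g → (∀ {x} → P x → Q (g · x)) →
                  ∀ {u v} → Reach P u v → Reach Q (g · u) (g · v)
    reach-image g f (stop p)     = stop (f p)
    reach-image g f (step p e w) = step (f p) (·-adj g e) (reach-image g f w)

    toward-image : ∀ g {t x v} → Toward t x v → Toward (image g t) (g · x) (g · v)
    toward-image g (N , w) = N , λ n N≤n → reach-image g (off-image g) (w n N≤n)

    toward-image⁻ : ∀ g {t x v} → Toward (image g t) (g · x) v → Toward t x (g ⁻¹ · v)
    toward-image⁻ g {t} {x} {v} (N , w) = N , λ n N≤n →
      subst₂ (λ y → Reach (Off y) (g ⁻¹ · v)) (·-inverseˡ g x) (·-inverseˡ g (Ray.at t n))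
        (reach-image (g ⁻¹) (off-image (g ⁻¹)) (w n N≤n))

    toward-transfer : ∀ t u → RayEquivalent t u → ∀ {x v} → Toward t x v → Toward u x v
    toward-transfer t u t~u {x} = side-transfer {t = t} {u} {F = ball radius x} id t~u

    equiv-sym : ∀ {t u : Ray D} → RayEquivalent t u → RayEquivalent u t
    equiv-sym (q , q∩t , q∩u) = q , q∩u , q∩t

    toward-tail : ∀ t x → ∃[ N ] (∀ n → N ≤ n → Toward t x (Ray.at t n))
    toward-tail t x with eventually-avoids t (ball radius x)
    ... | N , avoid = N , λ n N≤n → N , λ m N≤m → reach-tail (Ray.adjacent t) avoid N≤n N≤m

    separated-at-o : ∀ v → Toward r o v → Toward s o v → ⊥
    separated-at-o v (M , to-r) (N , to-s) = proj₂ (separator {r} {s} r≁s) v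
      (M , λ n → reach-map shrink ∘ to-r n) (N , λ n → reach-map shrink ∘ to-s n)
      where
      shrink : ∀ {x} → Off o x → x ∉ proj₁ (separator {r} {s} r≁s)
      shrink off x∈ = off (separator⊆ball _ x∈)

    images-separated : ∀ g {v} → Toward (image g r) (g · o) v → Toward (image g s) (g · o) v → ⊥
    images-separated g p q =
      separated-at-o _ (toward-image⁻ g {r} {o} p) (toward-image⁻ g {s} {o} q)

    -- A late vertex of `t` would lie on both sides of the ball around `g · o`.
    images-inequivalent : ∀ g {t} → RayEquivalent (image g r) t → RayEquivalent (image g s) t → ⊥
    images-inequivalent g {t} gr~t gs~t with toward-tail t (g · o)
    ... | N , tail = images-separated g
          (toward-transfer t (image g r) (equiv-sym {image g r} {t} gr~t) (tail N ℕ.≤-refl))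
          (toward-transfer t (image g s) (equiv-sym {image g s} {t} gs~t) (tail N ℕ.≤-refl))

    data Orientation (g : Aut) : Set (a ⊔ ℓ) where
      keeps : RayEquivalent (image g r) r → RayEquivalent (image g s) s → Orientation g
      flips : RayEquivalent (image g r) s → RayEquivalent (image g s) r → Orientation g

    orientation : ∀ g → Orientation g
    orientation g with two (image g r) | two (image g s)
    ... | inj₁ gr~r | inj₂ gs~s = keeps gr~r gs~s
    ... | inj₂ gr~s | inj₁ gs~r = flips gr~s gs~r
    ... | inj₁ gr~r | inj₁ gs~r = ⊥-elim (images-inequivalent g {r} gr~r gs~r)
    ... | inj₂ gr~s | inj₂ gs~s = ⊥-elim (images-inequivalent g {s} gr~s gs~s)

    -- An automorphism taking `o` to `x` carries the separation at `o` over to `x`; if it flips the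
    -- ends, the two sides merely change roles.
    separated : ∀ x v → Toward r x v → Toward s x v → ⊥
    separated x v p q with transitive o x
    ... | g , refl with orientation g
    ...   | keeps gr~r gs~s = images-separated g
              (toward-transfer r (image g r) (equiv-sym {image g r} {r} gr~r) p)
              (toward-transfer s (image g s) (equiv-sym {image g s} {s} gs~s) q)
    ...   | flips gr~s gs~r = images-separated g
              (toward-transfer s (image g r) (equiv-sym {image g r} {s} gr~s) q)
              (toward-transfer r (image g s) (equiv-sym {image g s} {r} gs~r) p)

    -- The indicator of R x minus that of L x. With it, the four cardinalities in the cocycle become
    -- one sum of differences of signs, which telescopes.
    data Sign (x v : V) : ℤ → Set (a ⊔ ℓ) where
      right  : Toward r x v → Sign x v 1ℤ
      left   : Toward s x v → Sign x v ℤ.-1ℤ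
      middle : ¬ Toward r x v → ¬ Toward s x v → Sign x v 0ℤ

    sign-view : ∀ x v → ∃ (Sign x v)
    sign-view x v with em {Toward r x v} | em {Toward s x v}
    ... | yes p | _     = 1ℤ , right p
    ... | no _  | yes q = ℤ.-1ℤ , left q
    ... | no ¬p | no ¬q = 0ℤ , middle ¬p ¬q

    abstract
      sign : V → V → ℤ
      sign x v = proj₁ (sign-view x v)

      sign-spec : ∀ x v → Sign x v (sign x v)
      sign-spec x v = proj₂ (sign-view x v)

    sign-unique : ∀ {x v} i j → Sign x v i → Sign x v j → i ≡ j
    sign-unique _ _ (right p)    (right q)    = refl
    sign-unique _ _ (right p)    (left q)     = ⊥-elim (separated _ _ p q)
    sign-unique _ _ (right p)    (middle q _) = ⊥-elim (q p)
    sign-unique _ _ (left p)     (right q)    = ⊥-elim (separated _ _ q p)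
    sign-unique _ _ (left p)     (left q)     = refl
    sign-unique _ _ (left p)     (middle _ q) = ⊥-elim (q p)
    sign-unique _ _ (middle p _) (right q)    = ⊥-elim (p q)
    sign-unique _ _ (middle _ p) (left q)     = ⊥-elim (p q)
    sign-unique _ _ (middle _ _) (middle _ _) = refl

    sign-≡ : ∀ {x v i} → Sign x v i → sign x v ≡ i
    sign-≡ {x} {v} σ = sign-unique _ _ (sign-spec x v) σ

    sign-adj : ∀ {x u v} → Off x u → Off x v → Adj u v → sign x u ≡ sign x v
    sign-adj {x} {u} {v} off-u off-v e with sign x u | sign-spec x u
    ... | _ | right p      = sym (sign-≡ (right (proj₁ p , λ n N≤n → step off-v (adj-sym e) (proj₂ p n N≤n))))
    ... | _ | left p       = sym (sign-≡ (left (proj₁ p , λ n N≤n → step off-v (adj-sym e) (proj₂ p n N≤n))))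
    ... | _ | middle ¬p ¬q = sym (sign-≡ (middle
            (λ p → ¬p (proj₁ p , λ n N≤n → step off-u e (proj₂ p n N≤n)))
            (λ q → ¬q (proj₁ q , λ n N≤n → step off-u e (proj₂ q n N≤n)))))

    IsUnit : ℤ → Set
    IsUnit i = i ≡ 1ℤ ⊎ i ≡ ℤ.-1ℤ

    toward-via : ∀ g {t u x v} → RayEquivalent (image g t) u → Toward t x v → Toward u (g · x) (g · v)
    toward-via g {t} {u} gt~u p = toward-transfer (image g t) u gt~u (toward-image g {t} p)

    toward-via⁻ : ∀ g {t u x v} → RayEquivalent (image g t) u → Toward u (g · x) (g · v) → Toward t x v
    toward-via⁻ g {t} {u} {x} {v} gt~u p = subst (Toward t x) (·-inverseˡ g v)
      (toward-image⁻ g {t} (toward-transfer u (image g t) (equiv-sym {image g t} {u} gt~u) p))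

    -- The unit depends only on whether `g` keeps or flips the ends; a flip exchanges left and right
    -- and so negates all signs.
    sign-image : ∀ g → ∃[ i ] IsUnit i × (∀ x v → sign (g · x) (g · v) ≡ i ℤ.* sign x v)
    sign-image g with orientation g
    ... | keeps gr~r gs~s = 1ℤ , inj₁ refl , λ x v → case sign-view x v of λ where
      (_ , right p)      → trans (sign-≡ (right (toward-via g {r} {r} gr~r p))) (cong (1ℤ ℤ.*_) (sym (sign-≡ (right p))))
      (_ , left p)       → trans (sign-≡ (left (toward-via g {s} {s} gs~s p))) (cong (1ℤ ℤ.*_) (sym (sign-≡ (left p))))
      (_ , middle ¬p ¬q) → trans (sign-≡ (middle (¬p ∘ toward-via⁻ g {r} {r} gr~r) (¬q ∘ toward-via⁻ g {s} {s} gs~s)))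
                                 (cong (1ℤ ℤ.*_) (sym (sign-≡ (middle ¬p ¬q))))
    ... | flips gr~s gs~r = ℤ.-1ℤ , inj₂ refl , λ x v → case sign-view x v of λ where
      (_ , right p)      → trans (sign-≡ (left (toward-via g {r} {s} gr~s p))) (cong (ℤ.-1ℤ ℤ.*_) (sym (sign-≡ (right p))))
      (_ , left p)       → trans (sign-≡ (right (toward-via g {s} {r} gs~r p))) (cong (ℤ.-1ℤ ℤ.*_) (sym (sign-≡ (left p))))
      (_ , middle ¬p ¬q) → trans (sign-≡ (middle (¬q ∘ toward-via⁻ g {s} {r} gs~r) (¬p ∘ toward-via⁻ g {r} {s} gr~s)))
                                 (cong (ℤ.-1ℤ ℤ.*_) (sym (sign-≡ (middle ¬p ¬q))))

    B : V → List V
    B = ball radius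

    Disjoint : V → V → Set a
    Disjoint x y = ∀ w → w ∈ B x → w ∉ B y

    disjoint-sym : ∀ {x y} → Disjoint x y → Disjoint y x
    disjoint-sym dis w w∈y w∈x = dis w w∈x w∈y

    near : V → List V
    near x = concatMap B (B x)

    far⇒disjoint : ∀ {x y} → y ∉ near x → Disjoint x y
    far⇒disjoint {x} {y} y∉ w w∈x w∈y =
      y∉ (∈-concatMap⁺ B (Any.map (λ { refl → ball-sym radius w∈y }) w∈x))

    module _ {t u : Ray D} (apart : ∀ x v → Toward t x v → Toward u x v → ⊥)
             {x y} (y→t : Toward t x y) (dis : Disjoint x y) where

      private
        -- The ball of `y` is connected and misses the ball of `x`, so it lies with its centre on
        -- the `t`-side of `x`, away from the `u`-side.
        off-y : ∀ {z} → Off x z → Toward u x z → Off y z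
        off-y off (N , z→u) z∈y = apart x y y→t (N , λ n N≤n →
          reach-trans (reach-sym (reach-map (λ {w} w∈y w∈x → dis w w∈x w∈y) (ball-reach radius z∈y)))
            (z→u n N≤n))

        push : ∀ {v w} → Reach (Off x) v w → Toward u x v → Reach (Off y) v w
        push (stop off) v→u = stop (off-y off v→u)
        push (step off e p) (N , v→u) = step (off-y off (N , v→u)) e
          (push p (N , λ n N≤n → step (reach-start p) (adj-sym e) (v→u n N≤n)))

      side-mono : ∀ {v} → Toward u x v → Toward u y v
      side-mono (N , v→u) = N , λ n N≤n → push (v→u n N≤n) (N , v→u)

      private
        entrance : ∀ {v} → Star Adj v x → Off x v → Toward u x v →
                   ∃[ w ] ∃[ w′ ] w ∈ B x × Adj w w′ × Toward u x w′
        entrance ε off v→u = contradiction (ball-centre radius x) off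
        entrance (_◅_ {j = v′} e es) off (N , v→u) with decᵃ (v′ ∈ B x)
        ... | yes v′∈ = v′ , _ , v′∈ , adj-sym e , (N , v→u)
        ... | no  v′∉ = entrance es v′∉ (N , λ n N≤n → step v′∉ (adj-sym e) (v→u n N≤n))

      -- The `u`-side of `x` has a vertex adjacent to the ball of `x`. Through the ball and that
      -- side `x` reaches the end of `u`, and neither of them meets the ball of `y`.
      side-centre : Toward u y x
      side-centre with toward-tail u x
      ... | M , tail with entrance (connected (Ray.at u M) x)
                            (reach-start (proj₂ (tail M ℕ.≤-refl) _ ℕ.≤-refl)) (tail M ℕ.≤-refl)
      ...   | w , w′ , w∈ , e , w′→u with side-mono w′→u
      ...     | N , w′→u′ = N , λ n N≤n →
        reach-trans (reach-sym (reach-map (λ {z} z∈x z∈y → dis z z∈x z∈y) (ball-reach radius w∈)))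
          (step (dis w w∈) e (w′→u′ n N≤n))

    separated′ : ∀ x v → Toward s x v → Toward r x v → ⊥
    separated′ x v p q = separated x v q p

    right⇒left : ∀ {x y} → Toward r x y → Disjoint x y → Toward s y x
    right⇒left = side-centre {r} {s} separated

    left⇒right : ∀ {x y} → Toward s x y → Disjoint x y → Toward r y x
    left⇒right = side-centre {s} {r} separated′

    -- The sum of shift u v over all vertices measures how far v is to the right
    -- of u.
    shift : V → V → V → ℤ
    shift u v x = sign u x ℤ.- sign v x

    -- Passing from `x` to `y`, the left side only grows and the right side only shrinks, both by
    -- `side-mono`.
    shift-nonneg : ∀ {x y} → Toward r x y → Disjoint x y → ∀ z → 0ℤ ℤ.≤ shift x y z
    shift-nonneg {x} {y} x<y dis z = ℤ.i≤j⇒0≤j-i (compare (sign-spec x z) (sign-spec y z))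
      where
      compare : ∀ {i j} → Sign x z i → Sign y z j → j ℤ.≤ i
      compare (right _)     (right _)    = ℤ.≤-refl
      compare (right _)     (left _)     = ℤ.-≤+
      compare (right _)     (middle _ _) = ℤ.+≤+ z≤n
      compare (left p)      (right q)    = ⊥-elim (separated y z q (side-mono {r} {s} separated x<y dis p))
      compare (left _)      (left _)     = ℤ.≤-refl
      compare (left p)      (middle _ q) = ⊥-elim (q (side-mono {r} {s} separated x<y dis p))
      compare (middle p _)  (right q)    = ⊥-elim (p
        (side-mono {s} {r} separated′ (right⇒left x<y dis) (disjoint-sym dis) q))
      compare (middle _ _)  (left _)     = ℤ.-≤+
      compare (middle _ _)  (middle _ _) = ℤ.≤-refl

    -- The vertex `x` lies in its own ball, hence has sign 0 there, and it is to the left of `y`.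
    -- This single summand gives the bound in `φ-pos`.
    shift-centre : ∀ {x y} → Toward r x y → Disjoint x y → shift x y x ≡ 1ℤ
    shift-centre {x} {y} x<y dis = cong₂ ℤ._-_
      (sign-≡ (middle (λ p → reach-start (proj₂ p _ ℕ.≤-refl) (ball-centre radius x))
                      (λ p → reach-start (proj₂ p _ ℕ.≤-refl) (ball-centre radius x))))
      (sign-≡ (left (right⇒left x<y dis)))

    eventually-right : ∀ x → ∃[ N ] (∀ n → N ≤ n → sign x (Ray.at r n) ≡ 1ℤ)
    eventually-right x with toward-tail r x
    ... | N , tail = N , λ n N≤n → sign-≡ (right (tail n N≤n))

    eventually-left : ∀ x → ∃[ N ] (∀ n → N ≤ n → sign x (Ray.at s n) ≡ ℤ.-1ℤ)
    eventually-left x with toward-tail s x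
    ... | N , tail = N , λ n N≤n → sign-≡ (left (tail n N≤n))

    -- Off the two balls both signs are constant along edges, so the vertices there with different
    -- signs have their boundary in the balls. Far out on `r` and on `s` the signs agree, and
    -- `finite-if-endless` applies.
    shift-finite : ∀ u v → Listed (λ x → Lift ℓ (sign u x ≢ sign v x))
    shift-finite u v = listed-⊆ split (listed-∪ (B u ++ B v , λ _ → id) outside)
      where
      U : V → Set (a ⊔ ℓ)
      U x = Lift ℓ (x ∉ B u ++ B v) × sign u x ≢ sign v x

      split : ∀ x → Lift ℓ (sign u x ≢ sign v x) → x ∈ B u ++ B v ⊎ U x
      split x (lift ≢) with decᵃ (x ∈ B u ++ B v)
      ... | yes x∈ = inj₁ x∈
      ... | no  x∉ = inj₂ (lift x∉ , ≢)

      boundary : ∀ {x y} → U x → Adj x y → ¬ U y → y ∈ B u ++ B v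
      boundary {x} {y} (lift x∉ , ≢) e ¬Uy = decidable-stable (decᵃ _) λ y∉ → ¬Uy (lift y∉ , λ eq →
        ≢ (trans (sign-adj (x∉ ∘ ∈-++⁺ˡ) (y∉ ∘ ∈-++⁺ˡ) e)
            (trans eq (sym (sign-adj (x∉ ∘ ∈-++⁺ʳ (B u)) (y∉ ∘ ∈-++⁺ʳ (B u)) e)))))

      same : ∀ {t : Ray D} {i} → (∀ x → ∃[ N ] (∀ n → N ≤ n → sign x (Ray.at t n) ≡ i)) → EventuallyOutside t U
      same ev = proj₁ (ev u) ℕ.⊔ proj₁ (ev v) , λ n ≤n (_ , ≢) →
        ≢ (trans (proj₂ (ev u) n (ℕ.m⊔n≤o⇒m≤o _ _ ≤n)) (sym (proj₂ (ev v) n (ℕ.m⊔n≤o⇒n≤o _ _ ≤n))))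

      outside : Listed U
      outside = finite-if-endless (B u ++ B v) boundary {r} {s} two (same {r} eventually-right) (same {s} eventually-left)

    support : V → V → List V
    support u v = deduplicate _≟_ (proj₁ (shift-finite u v))

    support-unique : ∀ u v → Unique (support u v)
    support-unique u v = Unique.deduplicate-! _≟_ (proj₁ (shift-finite u v))

    supports : ∀ u v → Supports (shift u v) (support u v)
    supports u v x ≢0 = ∈-deduplicate⁺ _≟_
      (proj₂ (shift-finite u v) x (lift λ eq → ≢0 (ℤ.i≡j⇒i-j≡0 eq)))

    abstract
      φ : V → V → ℤ
      φ u v = sum (shift u v) (support u v)

      φ-sum : ∀ u v xs → Unique xs → Supports (shift u v) xs → φ u v ≡ sum (shift u v) xs
      φ-sum u v xs uq sup = sum-support (support u v) xs (support-unique u v) uq (supports u v) sup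

    φ-add : ∀ u v w → φ u w ≡ φ u v ℤ.+ φ v w
    φ-add u v w = trans (φ-sum u w xs uq (λ x p → ∈-deduplicate⁺ _≟_ (∈-++⁺ˡ (supports u w x p))))
      (trans (sum-cong (λ x → telescope (sign u x) (sign v x) (sign w x)) xs)
        (trans (sum-+ (shift u v) (shift v w) xs)
          (sym (cong₂ ℤ._+_
            (φ-sum u v xs uq (λ x p → ∈-deduplicate⁺ _≟_ (∈-++⁺ʳ (support u w) (∈-++⁺ˡ (supports u v x p)))))
            (φ-sum v w xs uq (λ x p → ∈-deduplicate⁺ _≟_ (∈-++⁺ʳ (support u w) (∈-++⁺ʳ (support u v) (supports v w x p)))))))))
      where
      xs : List V
      xs = deduplicate _≟_ (support u w ++ support u v ++ support v w)
      uq : Unique xs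
      uq = Unique.deduplicate-! _≟_ (support u w ++ support u v ++ support v w)
      telescope : ∀ p q r → p ℤ.- r ≡ p ℤ.- q ℤ.+ (q ℤ.- r)
      telescope = solve-∀

    φ-pos : ∀ {x y} → Toward r x y → Disjoint x y → 1ℤ ℤ.≤ φ x y
    φ-pos {x} {y} x<y dis = subst (1ℤ ℤ.≤_) (sym (φ-sum x y _ (support-unique x y) (supports x y)))
      (sum-pos (shift-nonneg x<y dis) (ℤ.≤-reflexive (sym eq))
        (supports x y x λ eq0 → case trans (sym eq) eq0 of λ ()))
      where
      eq : shift x y x ≡ 1ℤ
      eq = shift-centre x<y dis

    φ-image : ∀ g → ∃[ i ] IsUnit i × (∀ u v → φ (g · u) (g · v) ≡ i ℤ.* φ u v)
    φ-image g with sign-image g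
    ... | i , unit , eq = i , unit , λ u v →
      trans (φ-sum (g · u) (g · v) (map (g ·_) (support u v))
               (Unique.map⁺ (·-injective g) (support-unique u v)) (cover u v))
        (trans (sum-map (shift (g · u) (g · v)) (support u v))
          (trans (sum-cong (scale u v) (support u v)) (trans (sum-* i (shift u v) (support u v))
          (cong (i ℤ.*_) (sym (φ-sum u v _ (support-unique u v) (supports u v)))))))
      where
      distrib : ∀ i p q → i ℤ.* p ℤ.- i ℤ.* q ≡ i ℤ.* (p ℤ.- q)
      distrib = solve-∀
      scale : ∀ u v x → shift (g · u) (g · v) (g · x) ≡ i ℤ.* shift u v x
      scale u v x = trans (cong₂ ℤ._-_ (eq u x) (eq v x)) (distrib i (sign u x) (sign v x))
      sum-map : ∀ h xs → sum h (map (g ·_) xs) ≡ sum (λ x → h (g · x)) xs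
      sum-map h []       = refl
      sum-map h (x ∷ xs) = cong (ℤ._+_ (h (g · x))) (sum-map h xs)
      cover : ∀ u v → Supports (shift (g · u) (g · v)) (map (g ·_) (support u v))
      cover u v x ≢0 = subst (_∈ map (g ·_) (support u v)) (·-inverseʳ g x)
        (∈-map⁺ (g ·_) (supports u v (g ⁻¹ · x) λ eq0 → ≢0
          (trans (cong (shift (g · u) (g · v)) (sym (·-inverseʳ g x)))
            (trans (scale u v (g ⁻¹ · x)) (trans (cong (i ℤ.*_) eq0) (ℤ.*-zeroʳ i))))))

    level : V → ℤ
    level = φ o

    level-diff : ∀ u v → level v ℤ.- level u ≡ φ u v
    level-diff u v = trans (cong (ℤ._- φ o u) (φ-add o u v)) (cancel (φ o u) (φ u v))
      where
      cancel : ∀ p q → p ℤ.+ q ℤ.- p ≡ q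
      cancel = solve-∀

    level-image : ∀ g → ∃[ i ] IsUnit i ×
                  (∀ u v → level (g · v) ℤ.- level (g · u) ≡ i ℤ.* (level v ℤ.- level u))
    level-image g = proj₁ (φ-image g) , proj₁ (proj₂ (φ-image g)) , λ u v →
      trans (level-diff (g · u) (g · v))
        (trans (proj₂ (proj₂ (φ-image g)) u v) (cong (proj₁ (φ-image g) ℤ.*_) (sym (level-diff u v))))

    level-<ʳ : ∀ {z v} → Toward r z v → Disjoint z v → level z ℤ.< level v
    level-<ʳ {z} {v} z<v dis = ℤ.suc[i]≤j⇒i<j (subst (ℤ._≤ level v) (ℤ.+-comm (level z) 1ℤ)
      (subst (level z ℤ.+ 1ℤ ℤ.≤_) (sym (φ-add o z v)) (ℤ.+-monoʳ-≤ (level z) (φ-pos z<v dis))))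

    level-<ˡ : ∀ {z v} → Toward s z v → Disjoint z v → level v ℤ.< level z
    level-<ˡ v<z dis = level-<ʳ (left⇒right v<z dis) (disjoint-sym dis)

    far-out : ∀ t z → ∃[ v ] Toward t z v × Disjoint z v
    far-out t z with toward-tail t z | eventually-avoids t (near z)
    ... | M , tail | N , avoid = Ray.at t (M ℕ.⊔ N) , tail _ (ℕ.m≤m⊔n M N) , far⇒disjoint (avoid _ (ℕ.m≤n⊔m M N))

    high : ∀ m → ∃[ z ] level o ℤ.+ + m ℤ.≤ level z
    high zero    = o , ℤ.≤-reflexive (ℤ.+-identityʳ (level o))
    high (suc m) with high m
    ... | z , m≤ with far-out r z
    ...   | v , z<v , dis = v , subst (ℤ._≤ level v) (shuffle (level o) (+ m))
            (ℤ.i<j⇒suc[i]≤j (ℤ.≤-<-trans m≤ (level-<ʳ z<v dis)))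
      where
      shuffle : ∀ p q → 1ℤ ℤ.+ (p ℤ.+ q) ≡ p ℤ.+ (1ℤ ℤ.+ q)
      shuffle = solve-∀

    low : ∀ m → ∃[ z ] level z ℤ.+ + m ℤ.≤ level o
    low zero    = o , ℤ.≤-reflexive (ℤ.+-identityʳ (level o))
    low (suc m) with low m
    ... | z , ≤m with far-out s z
    ...   | v , v<z , dis = v , ℤ.≤-trans (subst (ℤ._≤ level z ℤ.+ + m) (shuffle (level v) (+ m))
            (ℤ.+-monoˡ-≤ (+ m) (ℤ.i<j⇒suc[i]≤j (level-<ˡ v<z dis)))) ≤m
      where
      shuffle : ∀ p q → 1ℤ ℤ.+ p ℤ.+ q ≡ p ℤ.+ (1ℤ ℤ.+ q)
      shuffle = solve-∀

    ≤-+-distance : ∀ i j → i ℤ.≤ j ℤ.+ + ℤ.∣ i ℤ.- j ∣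
    ≤-+-distance i j = subst (ℤ._≤ j ℤ.+ + ℤ.∣ i ℤ.- j ∣) (cancel i j) (ℤ.+-monoʳ-≤ j (≤∣∣ (i ℤ.- j)))
      where
      ≤∣∣ : ∀ i → i ℤ.≤ + ℤ.∣ i ∣
      ≤∣∣ (+ n)    = ℤ.≤-refl
      ≤∣∣ -[1+ n ] = ℤ.-≤+
      cancel : ∀ i j → j ℤ.+ (i ℤ.- j) ≡ i
      cancel = solve-∀

    -- With `z` at level at least `k` and `w` at level at most `k`, a vertex far to the right of `z`
    -- is above `k` and one far to the left of `w` is below. What remains is near `z` or `w`, in
    -- their balls, or in a set with boundary in the balls that contains a tail of neither ray.
    level-finite : ∀ k → Listed (λ v → level v ≡ k)
    level-finite k with high ℤ.∣ k ℤ.- level o ∣ | low ℤ.∣ k ℤ.- level o ∣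
    ... | z , z-high | w , w-low = listed-⊆ split (listed-∪ (near z ++ near w , λ _ → id) inside)
      where
      F : List V
      F = B z ++ B w

      k≤z : k ℤ.≤ level z
      k≤z = ℤ.≤-trans (≤-+-distance k (level o)) z-high

      w≤k : level w ℤ.≤ k
      w≤k = ℤ.≮⇒≥ λ k<w → ℤ.<⇒≱ (ℤ.+-monoˡ-< (+ ℤ.∣ k ℤ.- level o ∣) k<w) (ℤ.≤-trans w-low
        (subst (λ d → level o ℤ.≤ k ℤ.+ + d) (ℤ.∣i-j∣≡∣j-i∣ (level o) k) (≤-+-distance (level o) k)))

      Between : V → Set (a ⊔ ℓ)
      Between v = ¬ Toward r z v × ¬ Toward s w v

      between-finite : Listed (λ v → Lift ℓ (v ∉ F) × Between v)
      between-finite = finite-if-endless F boundary {r} {s} two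
        (proj₁ (toward-tail r z) , λ n N≤n (_ , ¬p , _) → ¬p (proj₂ (toward-tail r z) n N≤n))
        (proj₁ (toward-tail s w) , λ n N≤n (_ , _ , ¬p) → ¬p (proj₂ (toward-tail s w) n N≤n))
        where
        boundary : ∀ {x y} → Lift ℓ (x ∉ F) × Between x → Adj x y → ¬ (Lift ℓ (y ∉ F) × Between y) → y ∈ F
        boundary (lift x∉ , ¬p , ¬q) e ¬Uy = decidable-stable (decᵃ _) λ y∉ → ¬Uy (lift y∉ ,
          (λ (N , p) → ¬p (N , λ n N≤n → step (x∉ ∘ ∈-++⁺ˡ) e (p n N≤n))) ,
          (λ (N , q) → ¬q (N , λ n N≤n → step (x∉ ∘ ∈-++⁺ʳ (B z)) e (q n N≤n))))

      inside : Listed (λ v → v ∈ F ⊎ Lift ℓ (v ∉ F) × Between v)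
      inside = listed-∪ (F , λ _ → id) between-finite

      split : ∀ v → level v ≡ k → v ∈ near z ++ near w ⊎ (v ∈ F ⊎ Lift ℓ (v ∉ F) × Between v)
      split v eq with decᵃ (v ∈ near z ++ near w) | decᵃ (v ∈ F)
      ... | yes v∈ | _      = inj₁ v∈
      ... | no _   | yes v∈ = inj₂ (inj₁ v∈)
      ... | no v∉  | no v∉F = inj₂ (inj₂ (lift v∉F ,
        (λ p → ℤ.<-irrefl (sym eq) (ℤ.≤-<-trans k≤z (level-<ʳ p (far⇒disjoint (v∉ ∘ ∈-++⁺ˡ))))) ,
        (λ q → ℤ.<-irrefl eq (ℤ.<-≤-trans (level-<ˡ q (far⇒disjoint (v∉ ∘ ∈-++⁺ʳ (near z)))) w≤k))))

unique-lookup : ∀ {a} {A : Set a} {xs : List A} → Unique xs → ∀ {i j} → lookup xs i ≡ lookup xs j → i ≡ j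
unique-lookup {xs = x ∷ xs} u {zero}  {zero}  eq = refl
unique-lookup {xs = x ∷ xs} u {zero}  {suc j} eq =
  contradiction (subst (_∈ xs) (sym eq) (∈-lookup {xs = xs} j)) (uniqueHead u)
unique-lookup {xs = x ∷ xs} u {suc i} {zero}  eq =
  contradiction (subst (_∈ xs) eq (∈-lookup {xs = xs} i)) (uniqueHead u)
unique-lookup {xs = x ∷ xs} (_ ∷ u) {suc i} {suc j} eq = cong suc (unique-lookup u eq)

-- Extension of partial isomorphisms by one vertex

module Extension {a ℓ} (D : Digraph a ℓ) where

  open Digraph D renaming (Vertex to V; Adjacent to Adj)
  open Walks D
  open Symmetry D

  Joined : List V → Set (a ⊔ ℓ)
  Joined l = ∀ {u v} → u ∈ l → v ∈ l → Reach (_∈ l) u v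

  SameArcs : V → V → List V → Set (a ⊔ ℓ)
  SameArcs x x′ l = (∀ y → y ∈ l → (x ⟶ y) ⇔ (x′ ⟶ y)) × (∀ y → y ∈ l → (y ⟶ x) ⇔ (y ⟶ x′))

  Attached : V → List V → Set (a ⊔ ℓ)
  Attached x l = l ≡ [] ⊎ ∃[ y ] y ∈ l × Adj x y

  -- The only form in which homogeneity is used: a connected set is fixed and one vertex attached to
  -- it is moved. Other maps are obtained by composing such automorphisms, and the property passes
  -- to the reversed digraph.
  OnePointExtension : Set (a ⊔ ℓ)
  OnePointExtension =
    ∀ l → Joined l → ∀ {x x′} → x ∉ l → x′ ∉ l → Attached x l → SameArcs x x′ l →
    Σ[ g ∈ Aut ] (g · x ≡ x′ × (∀ y → y ∈ l → g · y ≡ y))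

  joined-cons : ∀ {x l} → Joined l → Attached x l → Joined (x ∷ l)
  joined-cons jl att (here refl) (here refl) = stop (here refl)
  joined-cons jl (inj₁ refl) (here refl) (there ())
  joined-cons jl (inj₂ (y , y∈ , e)) (here refl) (there v∈) =
    step (here refl) e (reach-map there (jl y∈ v∈))
  joined-cons jl (inj₁ refl) (there ()) (here refl)
  joined-cons jl (inj₂ (y , y∈ , e)) (there u∈) (here refl) =
    reach-trans (reach-map there (jl u∈ y∈)) (step (there y∈) (adj-sym e) (stop (here refl)))
  joined-cons jl att (there u∈) (there v∈) = reach-map there (jl u∈ v∈)

  listing : ∀ {l} → Unique l → Fin (length l) ↣ V
  listing {l} u = mk↣ {to = lookup l} (unique-lookup u)

  joined⇒connected : ∀ {l} (u : Unique l) → Joined l → Connected (induced D (listing u))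
  joined⇒connected {l} u jl i j = go (jl (∈-lookup i) (∈-lookup j)) refl refl
    where
    arc : ∀ {i j} → Adj (lookup l i) (lookup l j) → SymClosure (Digraph._⟶_ (induced D (listing u))) i j
    arc (fwd e) = fwd e
    arc (bwd e) = bwd e
    go : ∀ {x y i j} → Reach (_∈ l) x y → lookup l i ≡ x → lookup l j ≡ y →
         Star (SymClosure (Digraph._⟶_ (induced D (listing u)))) i j
    go (stop _)     p q with unique-lookup u (trans p (sym q))
    ... | refl = ε
    go (step x∈ e r) refl q =
      arc (subst (Adj _) (Any.lookup-index (reach-start r)) e) ◅ go r (sym (Any.lookup-index (reach-start r))) q

  one-point-extension : DecidableEquality V → ConnectedHomogeneous D → OnePointExtension
  one-point-extension _≟_ homogeneous l jl {x} {x′} x∉ x′∉ att (out , inn) =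
    g , agrees zero , λ y y∈ → subst (λ z → g · z ≡ z) (sym (Any.lookup-index (to-k y∈))) (agrees (suc (Any.index (to-k y∈))))
    where
    k : List V
    k = deduplicate _≟_ l

    to-k : ∀ {y} → y ∈ l → y ∈ k
    to-k = ∈-deduplicate⁺ _≟_

    to-l : ∀ {y} → y ∈ k → y ∈ l
    to-l = ∈-deduplicate⁻ _≟_ l

    unique-k : ∀ {z} → z ∉ l → Unique (z ∷ k)
    unique-k z∉ = consUnique (z∉ ∘ to-l) (Unique.deduplicate-! _≟_ l)

    attached-k : ∀ {z} → Attached z l → Attached z k
    attached-k (inj₁ refl)         = inj₁ refl
    attached-k (inj₂ (y , y∈ , e)) = inj₂ (y , to-k y∈ , e)

    att′ : Attached x′ l
    att′ = case att of λ where
      (inj₁ l≡[])              → inj₁ l≡[]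
      (inj₂ (y , y∈ , fwd e)) → inj₂ (y , y∈ , fwd (Equivalence.to (out y y∈) e))
      (inj₂ (y , y∈ , bwd e)) → inj₂ (y , y∈ , bwd (Equivalence.to (inn y y∈) e))

    joined-k : Joined k
    joined-k u∈ v∈ = reach-map to-k (jl (to-l u∈) (to-l v∈))

    same : ∀ i j → (lookup (x ∷ k) i ⟶ lookup (x ∷ k) j) ⇔ (lookup (x′ ∷ k) i ⟶ lookup (x′ ∷ k) j)
    same zero    zero    = mk⇔ (⊥-elim ∘ irrefl refl) (⊥-elim ∘ irrefl refl)
    same zero    (suc j) = out _ (to-l (∈-lookup {xs = k} j))
    same (suc i) zero    = inn _ (to-l (∈-lookup {xs = k} i))
    same (suc i) (suc j) = mk⇔ id id

    extension : Σ[ g ∈ Aut ] (∀ i → g · lookup (x ∷ k) i ≡ lookup (x′ ∷ k) i)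
    extension = homogeneous (listing (unique-k x∉)) (listing (unique-k x′∉))
      (joined⇒connected (unique-k x∉) (joined-cons joined-k (attached-k att)))
      (joined⇒connected (unique-k x′∉) (joined-cons joined-k (attached-k att′)))
      -- The two listings differ only in their heads, so the isomorphism is the identity on
      -- positions.
      (record { bijection = mk↔ₛ′ id id (λ _ → refl) (λ _ → refl) ; arcs = same })

    g : Aut
    g = proj₁ extension

    agrees : ∀ i → g · lookup (x ∷ k) i ≡ lookup (x′ ∷ k) i
    agrees = proj₂ extension

-- Transitivity on vertices and on arcs

module Transitivity {a ℓ} (D : Digraph a ℓ) (extend : Extension.OnePointExtension D) where

  open Digraph D renaming (Vertex to V; Adjacent to Adj)
  open Symmetry D
  open Extension D

  asym : ∀ {u v} → u ⟶ v → ¬ v ⟶ u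
  asym e e′ = irrefl (antisym e e′) e

  arc⇒≢ : ∀ {u v} → u ⟶ v → u ≢ v
  arc⇒≢ e refl = irrefl refl e

  joined-[] : Joined []
  joined-[] ()

  joined-[_] : ∀ u → Joined [ u ]
  joined-[ u ] = joined-cons joined-[] (inj₁ refl)

  impossible : ∀ {p q} {P : Set p} {Q : Set q} → ¬ P → ¬ Q → P ⇔ Q
  impossible ¬p ¬q = mk⇔ (⊥-elim ∘ ¬p) (⊥-elim ∘ ¬q)

  vertex-transitive : ∀ u v → Σ[ g ∈ Aut ] g · u ≡ v
  vertex-transitive u v with extend [] joined-[] {u} {v} (λ ()) (λ ()) (inj₁ refl) ((λ _ ()) , (λ _ ()))
  ... | g , gu≡v , _ = g , gu≡v

  arc-transitive : ∀ {u v u′ v′} → u ⟶ v → u′ ⟶ v′ → Σ[ g ∈ Aut ] (g · u ≡ u′ × g · v ≡ v′)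
  arc-transitive {u} {v} {u′} {v′} e e′ with vertex-transitive u u′
  ... | g , refl with extend [ g · u ] joined-[ g · u ] {g · v} {v′}
                        (λ { (here eq) → arc⇒≢ (·-arc g e) (sym eq) })
                        (λ { (here eq) → arc⇒≢ e′ (sym eq) })
                        (inj₂ (_ , here refl , bwd (·-arc g e)))
                        ( (λ { _ (here refl) → impossible (asym (·-arc g e)) (asym e′) })
                        , (λ { _ (here refl) → mk⇔ (λ _ → e′) (λ _ → ·-arc g e) }))
  ...   | h , hgv≡v′ , fixes = h ∙ g , fixes _ (here refl) , hgv≡v′

-- All that later steps retain of the two ends. It is symmetric under reversal of arcs, with heights
-- negated.
record Grading {a ℓ} (D : Digraph a ℓ) : Set (a ⊔ ℓ) where
  open Digraph D
  field
    height        : Vertex → ℤ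
    height-arc    : ∀ {u v} → u ⟶ v → height v ≡ ℤ.suc (height u)
    height-finite : ∀ k → Listed (λ v → height v ≡ k)
    successor     : ∀ v → ∃[ w ] v ⟶ w
    predecessor   : ∀ v → ∃[ w ] w ⟶ v

-- The direction of arcs relative to the levels

module Orient {a ℓ} (em : ExcludedMiddle (a ⊔ ℓ)) (D : Digraph a ℓ)
              (connected : Connected D) (locallyFinite : LocallyFinite D) (r : Ray D)
              (extend : Extension.OnePointExtension D)
              (level : Digraph.Vertex D → ℤ)
              (level-image : ∀ (g : Automorphism D) → ∃[ i ] (i ≡ 1ℤ ⊎ i ≡ ℤ.-1ℤ) ×
                 (∀ u v → level (_≅_.to g v) ℤ.- level (_≅_.to g u) ≡ i ℤ.* (level v ℤ.- level u)))
              (level-finite : ∀ k → Listed (λ v → level v ≡ k)) where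

  open TwoEnds em D connected locallyFinite
  open Extension D
  open Transitivity D extend

  diff : V → V → ℤ
  diff u v = level v ℤ.- level u

  diff-trans : ∀ u v w → diff u w ≡ diff u v ℤ.+ diff v w
  diff-trans u v w = lemma (level u) (level v) (level w)
    where
    lemma : ∀ p q s → s ℤ.- p ≡ (q ℤ.- p) ℤ.+ (s ℤ.- q)
    lemma = solve-∀

  level-via : ∀ u v → level v ≡ level u ℤ.+ diff u v
  level-via u v = lemma (level u) (level v)
    where
    lemma : ∀ p q → q ≡ p ℤ.+ (q ℤ.- p)
    lemma = solve-∀

  diff-neg : ∀ u v → diff v u ≡ ℤ.- diff u v
  diff-neg u v = lemma (level u) (level v)
    where
    lemma : ∀ p q → p ℤ.- q ≡ ℤ.- (q ℤ.- p)
    lemma = solve-∀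

  unlisted : ∀ {p} {P : V → Set p} → Listed P → ¬ (∀ v → P v)
  unlisted (xs , P⊆xs) all with eventually-avoids r xs
  ... | N , avoid = avoid N ℕ.≤-refl (P⊆xs _ (all _))

  spread : ∀ {p} {P : V → Set p} → (∀ {u v} → Adj u v → P u → P v) → ∀ {u} → P u → ∀ v → P v
  spread {P = P} f {u} Pu v = go (connected u v) Pu
    where
    go : ∀ {x} → Star Adj x v → P x → P v
    go ε        Px = Px
    go (e ◅ es) Px = go es (f e Px)

  some-arc : ∃[ u ] ∃[ v ] u ⟶ v
  some-arc with Ray.adjacent r 0
  ... | fwd e = _ , _ , e
  ... | bwd e = _ , _ , e

  successor : ∀ v → ∃[ w ] v ⟶ w
  successor v with some-arc
  ... | x , y , e with vertex-transitive x v
  ...   | g , refl = _ , ·-arc g e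

  predecessor : ∀ v → ∃[ w ] w ⟶ v
  predecessor v with some-arc
  ... | x , y , e with vertex-transitive y v
  ...   | g , refl = _ , ·-arc g e

  arcs-alike : ∀ {u v u′ v′} → u ⟶ v → u′ ⟶ v′ → ∃[ i ] (i ≡ 1ℤ ⊎ i ≡ ℤ.-1ℤ) × diff u′ v′ ≡ i ℤ.* diff u v
  arcs-alike {u} {v} e e′ with arc-transitive e e′
  ... | g , refl , refl with level-image g
  ...   | i , unit , eq = i , unit , eq u v

  -- If one arc stayed within its level, all would by arc-transitivity, and the infinite connected
  -- `D` would occupy a single finite level.
  diff≢0 : ∀ {u v} → u ⟶ v → diff u v ≢ 0ℤ
  diff≢0 {u} {v} e eq0 = unlisted (level-finite (level u)) (spread same refl)
    where
    flat : ∀ {x y} → x ⟶ y → level y ≡ level x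
    flat {x} {y} e′ with arcs-alike e e′
    ... | i , _ , eq = ℤ.i-j≡0⇒i≡j _ _ (trans eq (trans (cong (i ℤ.*_) eq0) (ℤ.*-zeroʳ i)))
    same : ∀ {x y} → Adj x y → level x ≡ level u → level y ≡ level u
    same (fwd e′) p = trans (flat e′) p
    same (bwd e′) p = trans (sym (flat e′)) p

  -- The ends of a directed path of length two differ by d + i d in level, so
  -- they are not adjacent.
  two-step : ∀ {d i k} → d ≢ 0ℤ → i ≡ 1ℤ ⊎ i ≡ ℤ.-1ℤ → k ≡ 1ℤ ⊎ k ≡ ℤ.-1ℤ → d ℤ.+ i ℤ.* d ≢ k ℤ.* d
  two-step {d} {i} {k} d≢0 ui uk eq with ℤ.i*j≡0⇒i≡0∨j≡0 (1ℤ ℤ.+ i ℤ.- k) zero-product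
    where
    expand : ∀ d i k → (1ℤ ℤ.+ i ℤ.- k) ℤ.* d ≡ d ℤ.+ i ℤ.* d ℤ.- k ℤ.* d
    expand = solve-∀
    zero-product : (1ℤ ℤ.+ i ℤ.- k) ℤ.* d ≡ 0ℤ
    zero-product = trans (expand d i k) (ℤ.i≡j⇒i-j≡0 eq)
  ... | inj₂ d≡0 = d≢0 d≡0
  two-step d≢0 (inj₁ refl) (inj₁ refl) eq | inj₁ ()
  two-step d≢0 (inj₁ refl) (inj₂ refl) eq | inj₁ ()
  two-step d≢0 (inj₂ refl) (inj₁ refl) eq | inj₁ ()
  two-step d≢0 (inj₂ refl) (inj₂ refl) eq | inj₁ ()

  -- All arcs have the same nonzero difference up to sign; along the path these add up to an even
  -- multiple of it, while a chord would give an odd one.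
  no-triangle : ∀ {w v u} → w ⟶ v → v ⟶ u → ¬ Adj w u
  no-triangle {w} {v} {u} e f adj with arcs-alike e f
  ... | i , ui , eqᵢ with chord adj
    where
    chord : Adj w u → ∃[ k ] (k ≡ 1ℤ ⊎ k ≡ ℤ.-1ℤ) × diff w u ≡ k ℤ.* diff w v
    chord (fwd c) = arcs-alike e c
    chord (bwd c) with arcs-alike e c
    ... | k , inj₁ refl , eq = ℤ.-1ℤ , inj₂ refl ,
            trans (diff-neg u w) (trans (cong ℤ.-_ eq) (ℤ.neg-distribˡ-* 1ℤ (diff w v)))
    ... | k , inj₂ refl , eq = 1ℤ , inj₁ refl ,
            trans (diff-neg u w) (trans (cong ℤ.-_ eq) (ℤ.neg-distribˡ-* ℤ.-1ℤ (diff w v)))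
  ...   | k , uk , eqₖ = two-step (diff≢0 e) ui uk
          (trans (cong (ℤ._+_ (diff w v)) (sym eqᵢ)) (trans (sym (diff-trans w v u)) eqₖ))

  unit-fixing : ∀ {d i} → d ≢ 0ℤ → i ≡ 1ℤ ⊎ i ≡ ℤ.-1ℤ → d ≡ i ℤ.* d → i ≡ 1ℤ
  unit-fixing d≢0 (inj₁ i≡1) _ = i≡1
  unit-fixing {+ zero}     d≢0 (inj₂ refl) eq = contradiction refl d≢0
  unit-fixing {+ suc n}    d≢0 (inj₂ refl) ()
  unit-fixing { -[1+ n ] } d≢0 (inj₂ refl) ()

  -- Both paths are induced, so some automorphism fixes `w` and `v` and takes `u` to `u′`. Since it
  -- fixes an arc of nonzero difference, its unit is 1.
  same-out : ∀ {w v u u′} → w ⟶ v → v ⟶ u → v ⟶ u′ → diff v u ≡ diff v u′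
  same-out {w} {v} {u} {u′} e f f′ with extend (v ∷ w ∷ [])
      (joined-cons joined-[ w ] (inj₂ (w , here refl , bwd e)))
      (off f) (off f′) (inj₂ (v , here refl , bwd f))
      ( (λ { _ (here refl) → impossible (asym f) (asym f′)
           ; _ (there (here refl)) → impossible (no-triangle e f ∘ bwd) (no-triangle e f′ ∘ bwd) })
      , (λ { _ (here refl) → mk⇔ (λ _ → f′) (λ _ → f)
           ; _ (there (here refl)) → impossible (no-triangle e f ∘ fwd) (no-triangle e f′ ∘ fwd) }))
    where
    off : ∀ {x} → v ⟶ x → x ∉ v ∷ w ∷ []
    off c (here refl)         = irrefl refl c
    off c (there (here refl)) = asym e c
  ... | g , gu≡u′ , fixes with level-image g
  ...   | i , ui , eq with unit-fixing (diff≢0 e) ui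
                             (trans (sym (cong₂ diff (fixes w (there (here refl))) (fixes v (here refl)))) (eq w v))
  ...     | refl = sym (trans (sym (cong₂ diff (fixes v (here refl)) gu≡u′))
                     (trans (eq v u) (ℤ.*-identityˡ (diff v u))))

  paths-alike : ∀ {w v u w′ v′ u′} → w ⟶ v → v ⟶ u → w′ ⟶ v′ → v′ ⟶ u′ →
                ∃[ i ] diff w′ v′ ≡ i ℤ.* diff w v × diff v′ u′ ≡ i ℤ.* diff v u
  paths-alike {w} {v} {u} e f e′ f′ with arc-transitive e e′
  ... | g , refl , refl with level-image g
  ...   | i , _ , eq = i , eq w v , trans (same-out e′ f′ (·-arc g f)) (eq v u)

  -- By connectedness all level differences are multiples of `c`; the height is the quotient, which
  -- is unique because `c` can be cancelled.
  rescale : ∀ c → c ≢ 0ℤ → (∀ {u v} → u ⟶ v → diff u v ≡ c) → Grading D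
  rescale c c≢0 const = record
    { height = λ v → proj₁ (multiple v)
    ; height-arc = height-arc
    ; height-finite = λ k → listed-⊆ (λ v eq → trans (level-via o v) (cong (ℤ._+_ (level o))
        (trans (proj₂ (multiple v)) (cong (ℤ._* c) eq)))) (level-finite (level o ℤ.+ k ℤ.* c))
    ; successor = successor
    ; predecessor = predecessor
    }
    where
    instance
      c-nonZero : ℤ.NonZero c
      c-nonZero = ℤ.≢-nonZero c≢0

    o : V
    o = Ray.at r 0

    one-more : ∀ h c → h ℤ.* c ℤ.+ c ≡ (1ℤ ℤ.+ h) ℤ.* c
    one-more = solve-∀

    one-less : ∀ h c → h ℤ.* c ℤ.- c ≡ (h ℤ.- 1ℤ) ℤ.* c
    one-less = solve-∀

    along : ∀ {u v} → Adj u v → ∃[ h ] diff o u ≡ h ℤ.* c → ∃[ h ] diff o v ≡ h ℤ.* c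
    along {u} {v} (fwd e) (h , eq) = ℤ.suc h ,
      trans (diff-trans o u v) (trans (cong₂ ℤ._+_ eq (const e)) (one-more h c))
    along {u} {v} (bwd e) (h , eq) = h ℤ.- 1ℤ ,
      trans (diff-trans o u v) (trans (cong₂ ℤ._+_ eq (trans (diff-neg v u) (cong ℤ.-_ (const e)))) (one-less h c))

    multiple : ∀ v → ∃[ h ] diff o v ≡ h ℤ.* c
    multiple = spread along {o} (0ℤ , ℤ.+-inverseʳ (level o))

    height-arc : ∀ {u v} → u ⟶ v → proj₁ (multiple v) ≡ ℤ.suc (proj₁ (multiple u))
    height-arc {u} {v} e = ℤ.*-cancelʳ-≡ _ _ c (trans (sym (proj₂ (multiple v)))
      (trans (diff-trans o u v) (trans (cong₂ ℤ._+_ (proj₂ (multiple u)) (const e)) (one-more (proj₁ (multiple u)) c))))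

  module _ {w v u} (e : w ⟶ v) (f : v ⟶ u) where

    -- By `paths-alike` all directed paths of length two are straight. This carries the common
    -- difference forwards along arcs; backwards, `same-out` is needed to reach the other out-arcs
    -- of the tail.
    unfolded : diff v u ≡ diff w v → Grading D
    unfolded straight = rescale (diff w v) (diff≢0 e) λ {x} {y} → spread along base x y
      where
      straight′ : ∀ {x y z} → x ⟶ y → y ⟶ z → diff y z ≡ diff x y
      straight′ p q with paths-alike e f p q
      ... | i , eq₁ , eq₂ = trans eq₂ (trans (cong (i ℤ.*_) straight) (sym eq₁))
      Const : V → Set (a ⊔ ℓ)
      Const x = ∀ y → x ⟶ y → diff x y ≡ diff w v
      base : Const v
      base y q = straight′ e q
      along : ∀ {x y} → Adj x y → Const x → Const y
      along {x} {y} (fwd p) cx z q = trans (straight′ p q) (cx y p)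
      along {x} {y} (bwd p) cx z q with successor x | predecessor y
      ... | t , q′ | _ , p′ = trans (same-out p′ q p) (trans (sym (straight′ p q′)) (cx t q′))

    -- If directed paths turned back at every vertex, D would occupy only two levels.
    folded : diff v u ≡ ℤ.- diff w v → ⊥
    folded turn = unlisted (listed-∪ (level-finite (level w)) (level-finite (level v)))
        λ x → [ inj₁ ∘ proj₁ , inj₂ ∘ proj₁ ]′ (spread along (inj₂ (refl , base)) x)
      where
      turn′ : ∀ {x y z} → x ⟶ y → y ⟶ z → diff y z ≡ ℤ.- diff x y
      turn′ {x} {y} p q with paths-alike e f p q
      ... | i , eq₁ , eq₂ = trans eq₂ (trans (cong (i ℤ.*_) turn)
              (trans (sym (ℤ.neg-distribʳ-* i (diff w v))) (cong ℤ.-_ (sym eq₁))))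
      base : ∀ y → v ⟶ y → diff v y ≡ ℤ.- diff w v
      base y = turn′ e
      Folded : V → Set (a ⊔ ℓ)
      Folded x = level x ≡ level w × (∀ y → x ⟶ y → diff x y ≡ diff w v) ⊎
                 level x ≡ level v × (∀ y → x ⟶ y → diff x y ≡ ℤ.- diff w v)
      up : level w ℤ.+ diff w v ≡ level v
      up = sym (level-via w v)
      down : level v ℤ.- diff w v ≡ level w
      down = trans (cong (ℤ._+_ (level v)) (sym (diff-neg w v))) (sym (level-via v w))
      along : ∀ {x y} → Adj x y → Folded x → Folded y
      along {x} {y} (fwd p) (inj₁ (lx , ox)) = inj₂
        ( trans (level-via x y) (trans (cong₂ ℤ._+_ lx (ox y p)) up)
        , λ z q → trans (turn′ p q) (cong ℤ.-_ (ox y p)))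
      along {x} {y} (fwd p) (inj₂ (lx , ox)) = inj₁
        ( trans (level-via x y) (trans (cong₂ ℤ._+_ lx (ox y p)) down)
        , λ z q → trans (turn′ p q) (trans (cong ℤ.-_ (ox y p)) (ℤ.neg-involutive _)))
      along {x} {y} (bwd p) (inj₁ (lx , ox)) with successor x | predecessor y
      ... | t , q | _ , p′ = inj₂
        ( trans (level-via x y) (trans (cong₂ ℤ._+_ lx (trans (diff-neg y x) (trans (sym (turn′ p q)) (ox t q)))) up)
        , λ z q′ → trans (same-out p′ q′ p) (trans (trans (sym (ℤ.neg-involutive _)) (cong ℤ.-_ (sym (turn′ p q)))) (cong ℤ.-_ (ox t q))))
      along {x} {y} (bwd p) (inj₂ (lx , ox)) with successor x | predecessor y
      ... | t , q | _ , p′ = inj₁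
        ( trans (level-via x y) (trans (cong₂ ℤ._+_ lx (trans (diff-neg y x) (trans (sym (turn′ p q)) (ox t q)))) down)
        , λ z q′ → trans (same-out p′ q′ p) (trans (trans (sym (ℤ.neg-involutive _)) (cong ℤ.-_ (sym (turn′ p q)))) (trans (cong ℤ.-_ (ox t q)) (ℤ.neg-involutive _))))

  grading : Grading D
  grading with some-arc
  ... | w , v , e with successor v
  ...   | u , f with arcs-alike e f
  ...     | _ , inj₁ refl , eq = unfolded e f (trans eq (ℤ.*-identityˡ _))
  ...     | _ , inj₂ refl , eq = ⊥-elim (folded e f (trans eq (ℤ.-1*i≡-i _)))

coinciding-maps : ∀ {n} (F : ℕ → Fin n → Fin n) → ∃[ i ] ∃[ j ] i < j × (∀ k → F i k ≡ F j k)
-- The self-maps of `Fin n` are coded by the `n ^ n` elements of `Fin (n ^ n)`.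
coinciding-maps {n} F with Fin.pigeonhole (ℕ.n<1+n (n ℕ.^ n)) (λ m → funToFin (F (toℕ m)))
... | i , j , i<j , eq = toℕ i , toℕ j , i<j , λ k →
  trans (sym (Fin.finToFun-funToFin (F (toℕ i)) k))
    (trans (cong (λ c → finToFun c k) eq) (Fin.finToFun-funToFin (F (toℕ j)) k))

-- Digraphs with finite levels

module Layered {a ℓ} (em : ExcludedMiddle (a ⊔ ℓ)) (D : Digraph a ℓ) (connected : Connected D)
               (extend : Extension.OnePointExtension D)
               (grading : Grading D) where

  open Classical {a} {ℓ} em
  open Digraph D renaming (Vertex to V; Adjacent to Adj)
  open Walks D
  open Symmetry D
  open Extension D
  open Transitivity D extend
  open Grading grading

  infix 4 _≟_
  _≟_ : DecidableEquality V
  u ≟ v = decᵃ (u ≡ v)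

  suc-injective : ∀ {i j} → ℤ.suc i ≡ ℤ.suc j → i ≡ j
  suc-injective {i} {j} = ℤ+.∙-cancelˡ 1ℤ i j

  height-< : ∀ {u v} → u ⟶ v → height u ℤ.< height v
  height-< {u} e = subst (height u ℤ.<_) (sym (height-arc e)) (ℤ.suc[i]≤j⇒i<j ℤ.≤-refl)

  no-descent : ∀ {u v} → height v ℤ.≤ height u → ¬ u ⟶ v
  no-descent v≤u e = ℤ.<⇒≱ (height-< e) v≤u

  no-jump : ∀ {u v w} → u ⟶ v → height v ℤ.< height w → ¬ u ⟶ w
  no-jump e v<w e′ = ℤ.<-irrefl (trans (height-arc e) (sym (height-arc e′))) v<w

  siblings-level : ∀ {x y y′} → x ⟶ y → x ⟶ y′ → height y ≡ height y′
  siblings-level e e′ = trans (height-arc e) (sym (height-arc e′))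

  coparents-level : ∀ {x x′ y} → x ⟶ y → x′ ⟶ y → height x ≡ height x′
  coparents-level e e′ = suc-injective (trans (sym (height-arc e)) (height-arc e′))

  ·-arc⁻ : ∀ g {u v} → g · u ⟶ g · v → u ⟶ v
  ·-arc⁻ g = Equivalence.from (_≅_.arcs g _ _)

  -- Every arc now goes up by exactly one, so automorphisms translate heights and no sign remains.
  offset : ∀ g u v → height (g · v) ≡ height v ℤ.+ (height (g · u) ℤ.- height u)
  offset g u v = go (connected u v) (start (height u) (height (g · u)))
    where
    k : ℤ
    k = height (g · u) ℤ.- height u
    start : ∀ p q → q ≡ p ℤ.+ (q ℤ.- p)
    start = solve-∀
    along : ∀ {x y} → Adj x y → height (g · x) ≡ height x ℤ.+ k → height (g · y) ≡ height y ℤ.+ k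
    along {x} {y} (fwd e) eq = trans (height-arc (·-arc g e)) (trans (cong ℤ.suc eq)
      (trans (sym (ℤ.+-assoc 1ℤ (height x) k)) (cong (ℤ._+ k) (sym (height-arc e)))))
    along {x} {y} (bwd e) eq = suc-injective (trans (sym (height-arc (·-arc g e))) (trans eq
      (trans (cong (ℤ._+ k) (height-arc e)) (ℤ.+-assoc 1ℤ (height y) k))))
    go : ∀ {x} → Star Adj x v → height (g · x) ≡ height x ℤ.+ k → height (g · v) ≡ height v ℤ.+ k
    go ε        eq = eq
    go (e ◅ es) eq = go es (along e eq)

  level-preserved : ∀ g u v → height v ≡ height (g · u) → height (g ⁻¹ · v) ≡ height u
  level-preserved g u v eq = trans (offset (g ⁻¹) (g · u) v)
    (trans (cong₂ (λ p q → p ℤ.+ (height q ℤ.- height (g · u))) eq (·-inverseˡ g u))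
      (cancel (height (g · u)) (height u)))
    where
    cancel : ∀ p q → p ℤ.+ (q ℤ.- p) ≡ q
    cancel = solve-∀

  -- Siblings have equal height, hence no arc between them, so all such claws are induced.
  claw-transitive : ∀ {x y z x′ y′ z′} → x ⟶ y → x ⟶ z → y ≢ z → x′ ⟶ y′ → x′ ⟶ z′ → y′ ≢ z′ →
                    Σ[ g ∈ Aut ] (g · x ≡ x′ × g · y ≡ y′ × g · z ≡ z′)
  claw-transitive {x} {y} {z} {z′ = z′} e f y≢z e′ f′ y′≢z′ with arc-transitive e e′
  ... | g , refl , refl with extend (g · y ∷ g · x ∷ [])
        (joined-cons joined-[ g · x ] (inj₂ (_ , here refl , bwd e′)))
        {g · z} {z′}
        (λ { (here eq) → y≢z (·-injective g (sym eq))
           ; (there (here eq)) → arc⇒≢ (·-arc g f) (sym eq) })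
        (λ { (here eq) → y′≢z′ (sym eq)
           ; (there (here eq)) → arc⇒≢ f′ (sym eq) })
        (inj₂ (g · x , there (here refl) , bwd (·-arc g f)))
        ( (λ { _ (here refl) → impossible (level (·-arc g f) e′) (level f′ e′)
             ; _ (there (here refl)) → impossible (asym (·-arc g f)) (asym f′) })
        , (λ { _ (here refl) → impossible (level e′ (·-arc g f)) (level e′ f′)
             ; _ (there (here refl)) → mk⇔ (λ _ → f′) (λ _ → ·-arc g f) }))
    where
    level : ∀ {p q r} → p ⟶ q → p ⟶ r → ¬ q ⟶ r
    level c c′ = no-descent (ℤ.≤-reflexive (siblings-level c′ c))
  ...   | h , eq , fixes = h ∙ g , fixes _ (there (here refl)) , fixes _ (here refl) , eq

  level-list : V → List V
  level-list o = filter (λ v → height v ℤ.≟ height o) (proj₁ (height-finite (height o)))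

  ∈-level⁺ : ∀ {o v} → height v ≡ height o → v ∈ level-list o
  ∈-level⁺ {o} {v} eq = ∈-filter⁺ (λ v → height v ℤ.≟ height o) (proj₂ (height-finite (height o)) v eq) eq

  ∈-level⁻ : ∀ {o v} → v ∈ level-list o → height v ≡ height o
  ∈-level⁻ {o} v∈ = proj₂ (∈-filter⁻ (λ v → height v ℤ.≟ height o) {xs = proj₁ (height-finite (height o))} v∈)

  module Branching {x₀ y₀ z₀} (x→y : x₀ ⟶ y₀) (x→z : x₀ ⟶ z₀) (y≢z : y₀ ≢ z₀) where

    children : ∀ v → ∃[ y ] ∃[ z ] v ⟶ y × v ⟶ z × y ≢ z
    children v with vertex-transitive x₀ v
    ... | g , refl = g · y₀ , g · z₀ , ·-arc g x→y , ·-arc g x→z , y≢z ∘ ·-injective g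

    child sibling : V → V
    child v   = proj₁ (children v)
    sibling v = proj₁ (proj₂ (children v))

    child-arc : ∀ v → v ⟶ child v
    child-arc v = proj₁ (proj₂ (proj₂ (children v)))

    sibling-arc : ∀ v → v ⟶ sibling v
    sibling-arc v = proj₁ (proj₂ (proj₂ (proj₂ (children v))))

    child≢sibling : ∀ v → child v ≢ sibling v
    child≢sibling v = proj₂ (proj₂ (proj₂ (proj₂ (children v))))

    spine : ℕ → V
    spine zero    = x₀
    spine (suc n) = child (spine n)

    initial : ℕ → List V
    initial zero    = [ x₀ ]
    initial (suc n) = spine (suc n) ∷ initial n

    initial-joined : ∀ n → Joined (initial n)
    initial-joined zero    = joined-[ x₀ ]
    initial-joined (suc n) = joined-cons (initial-joined n)
      (inj₂ (spine n , spine∈ n , bwd (child-arc (spine n))))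
      where
      spine∈ : ∀ n → spine n ∈ initial n
      spine∈ zero    = here refl
      spine∈ (suc n) = here refl

    ∈-initial : ∀ {m n} → m ≤ n → spine m ∈ initial n
    ∈-initial {n = zero}  z≤n = here refl
    ∈-initial {m} {suc n} m≤ with ℕ.m≤n⇒m<n∨m≡n m≤
    ... | inj₁ m<     = there (∈-initial (ℕ.s≤s⁻¹ m<))
    ... | inj₂ refl   = here refl

    below : ∀ n {y} → y ∈ initial n → y ≡ spine n ⊎ height y ℤ.< height (spine n)
    below zero    (here refl) = inj₁ refl
    below (suc n) (here refl) = inj₁ refl
    below (suc n) (there y∈) with below n y∈
    ... | inj₁ refl = inj₂ (height-< (child-arc (spine n)))
    ... | inj₂ y<   = inj₂ (ℤ.<-trans y< (height-< (child-arc (spine n))))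

    -- For reasons of height, the child and the sibling of `spine n` are joined to nothing in
    -- `initial n` but `spine n`. So the child can be moved to the sibling with the path fixed.
    mover : ∀ n → Σ[ g ∈ Aut ] (∀ m → m ≤ n → g · spine m ≡ spine m) × g · spine (suc n) ≢ spine (suc n)
    mover n with extend (initial n) (initial-joined n) (off (child-arc (spine n))) (off (sibling-arc (spine n)))
                   (inj₂ (spine n , ∈-initial ℕ.≤-refl , bwd (child-arc (spine n))))
                   ((λ y y∈ → impossible (no-descent (lower′ (child-arc (spine n)) y∈)) (no-descent (lower′ (sibling-arc (spine n)) y∈)))
                   , into)
      where
      lower′ : ∀ {x} → spine n ⟶ x → ∀ {y} → y ∈ initial n → height y ℤ.≤ height x
      lower′ e y∈ with below n y∈
      ... | inj₁ refl = ℤ.<⇒≤ (height-< e)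
      ... | inj₂ y<   = ℤ.<⇒≤ (ℤ.<-trans y< (height-< e))
      off : ∀ {x} → spine n ⟶ x → x ∉ initial n
      off e x∈ with below n x∈
      ... | inj₁ refl = irrefl refl e
      ... | inj₂ x<   = ℤ.<-asym x< (height-< e)
      low : ∀ {x y} → spine n ⟶ x → height y ℤ.< height (spine n) → ¬ y ⟶ x
      low e y< e′ = ℤ.<-irrefl (coparents-level e′ e) y<
      into : ∀ y → y ∈ initial n → (y ⟶ child (spine n)) ⇔ (y ⟶ sibling (spine n))
      into y y∈ with below n y∈
      ... | inj₁ refl = mk⇔ (λ _ → sibling-arc (spine n)) (λ _ → child-arc (spine n))
      ... | inj₂ y<   = impossible (low (child-arc (spine n)) y<) (low (sibling-arc (spine n)) y<)
    ... | g , moved , fixes = g , (λ m m≤n → fixes _ (∈-initial m≤n)) ,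
          λ fixed → child≢sibling (spine n) (trans (sym fixed) moved)

    size : ℕ
    size = length (level-list x₀)

    at : Fin size → V
    at = lookup (level-list x₀)

    at-level : ∀ i → height (at i) ≡ height x₀
    at-level i = ∈-level⁻ {x₀} (∈-lookup i)

    position : ∀ {v} → height v ≡ height x₀ → Fin size
    position eq = Any.index (∈-level⁺ {x₀} eq)

    at-position : ∀ {v} (eq : height v ≡ height x₀) → at (position eq) ≡ v
    at-position eq = sym (Any.lookup-index (∈-level⁺ {x₀} eq))

    height-spine : ∀ n → height (spine n) ≡ height x₀ ℤ.+ + n
    height-spine zero    = sym (ℤ.+-identityʳ (height x₀))
    height-spine (suc n) = trans (height-arc (child-arc (spine n)))
      (trans (cong ℤ.suc (height-spine n)) (raise (height x₀) (+ n)))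
      where
      raise : ∀ p q → 1ℤ ℤ.+ (p ℤ.+ q) ≡ p ℤ.+ (1ℤ ℤ.+ q)
      raise = solve-∀

    module _ (determined : ∀ {y z} → (∀ x → x ⟶ y → x ⟶ z) → y ≡ z) where

      -- Since `g` and `h` agree on the in-neighbours of `v`, those of `g · v` are also
      -- in-neighbours of `h · v`, and `determined` identifies the two.
      agree-above : ∀ g h → (∀ {v} → height v ≡ height x₀ → g · v ≡ h · v) →
                    ∀ n {v} → height v ≡ height x₀ ℤ.+ + n → g · v ≡ h · v
      agree-above g h base zero    eq = base (trans eq (ℤ.+-identityʳ (height x₀)))
      agree-above g h base (suc n) {v} eq = determined λ x e →
        subst (_⟶ h · v) (trans (sym (agree-above g h base n (below-v e))) (·-inverseʳ g x)) (·-arc h (pull e))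
        where
        pull : ∀ {x} → x ⟶ g · v → g ⁻¹ · x ⟶ v
        pull {x} e = ·-arc⁻ g (subst (_⟶ g · v) (sym (·-inverseʳ g x)) e)
        raise : ∀ p q → p ℤ.+ (1ℤ ℤ.+ q) ≡ 1ℤ ℤ.+ (p ℤ.+ q)
        raise = solve-∀
        below-v : ∀ {x} → x ⟶ g · v → height (g ⁻¹ · x) ≡ height x₀ ℤ.+ + n
        below-v e = suc-injective (trans (sym (height-arc (pull e))) (trans eq (raise (height x₀) (+ n))))

      private
        g : ℕ → Aut
        g n = proj₁ (mover n)

        stays : ∀ n {v} → height v ≡ height x₀ → height (g n · v) ≡ height x₀
        stays n {v} eq = trans (offset (g n) x₀ v)
          (trans (cong₂ (λ p q → p ℤ.+ (height q ℤ.- height x₀)) eq (proj₁ (proj₂ (mover n)) 0 z≤n))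
            (cancel (height x₀)))
          where
          cancel : ∀ p → p ℤ.+ (p ℤ.- p) ≡ p
          cancel = solve-∀

        action : ℕ → Fin size → Fin size
        action n i = position (stays n (at-level i))

      -- All movers fix `x₀`, hence act on its finite level, and two of them, for `i < j`, act there
      -- alike. They then agree on `spine (suc i)`, which the mover of `j` fixes and that of `i`
      -- does not.
      undetermined : ⊥
      undetermined = clash (coinciding-maps action)
        where
        clash : ∃[ i ] ∃[ j ] i < j × (∀ k → action i k ≡ action j k) → ⊥
        clash (i , j , i<j , same-action) = proj₂ (proj₂ (mover i))
          (trans (agree-above (g i) (g j) agree (suc i) (height-spine (suc i)))
            (proj₁ (proj₂ (mover j)) (suc i) i<j))
          where
          agree : ∀ {v} → height v ≡ height x₀ → g i · v ≡ g j · v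
          agree {v} eq = subst (λ w → g i · w ≡ g j · w) (at-position eq)
            (trans (sym (at-position (stays i (at-level (position eq)))))
              (trans (cong at (same-action (position eq))) (at-position (stays j (at-level (position eq))))))

  -- If some two siblings y ≠ z satisfy N⁻(y) ⊆ N⁻(z), then all siblings do by
  -- homogeneity; otherwise in-neighbourhoods determine vertices.
  rectangle : ∀ {x y z w} → x ⟶ y → x ⟶ z → w ⟶ y → w ⟶ z
  rectangle {x} {y} {z} {w} e f c with y ≟ z
  ... | yes refl = c
  ... | no  y≢z with em {∃[ x ] ∃[ y ] ∃[ z ] x ⟶ y × x ⟶ z × y ≢ z × (∀ w → w ⟶ y → w ⟶ z)}
  ...   | yes (x′ , y′ , z′ , e′ , f′ , y′≢z′ , twins) with claw-transitive e′ f′ y′≢z′ e f y≢z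
  ...     | g , refl , refl , refl = subst (_⟶ g · z′) (·-inverseʳ g w)
            (·-arc g (twins _ (·-arc⁻ g (subst (_⟶ g · y′) (sym (·-inverseʳ g w)) c))))
  rectangle {x} {y} {z} {w} e f c | no y≢z | no none = ⊥-elim (Branching.undetermined e f y≢z determined)
    where
    determined : ∀ {y z} → (∀ x → x ⟶ y → x ⟶ z) → y ≡ z
    determined {y} {z} sub = decidable-stable (y ≟ z) λ y≢z → case predecessor y of λ where
      (x , e) → none (x , y , z , e , sub x e , y≢z , sub)

  data Path : ℕ → V → V → Set (a ⊔ ℓ) where
    []  : ∀ {v} → Path 0 v v
    _∷_ : ∀ {n u v w} → u ⟶ v → Path n v w → Path (suc n) u w

  verts : ∀ {n u w} → Path n u w → List V
  verts {w = w} []      = [ w ]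
  verts (_∷_ {u = u} e p) = u ∷ verts p

  start∈ : ∀ {n u w} (p : Path n u w) → u ∈ verts p
  start∈ []      = here refl
  start∈ (e ∷ p) = here refl

  end∈ : ∀ {n u w} (p : Path n u w) → w ∈ verts p
  end∈ []      = here refl
  end∈ (e ∷ p) = there (end∈ p)

  verts-joined : ∀ {n u w} (p : Path n u w) → Joined (verts p)
  verts-joined {w = w} []      = joined-[ w ]
  verts-joined         (e ∷ p) = joined-cons (verts-joined p) (inj₂ (_ , start∈ p , fwd e))

  verts-above : ∀ {n u w} (p : Path n u w) {y} → y ∈ verts p → y ≡ u ⊎ height u ℤ.< height y
  verts-above []      (here refl) = inj₁ refl
  verts-above (e ∷ p) (here refl) = inj₁ refl
  verts-above (e ∷ p) (there y∈) with verts-above p y∈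
  ... | inj₁ refl = inj₂ (height-< e)
  ... | inj₂ <y   = inj₂ (ℤ.<-trans (height-< e) <y)

  verts-≥ : ∀ {n u w} (p : Path n u w) {y} → y ∈ verts p → height u ℤ.≤ height y
  verts-≥ p y∈ with verts-above p y∈
  ... | inj₁ refl = ℤ.≤-refl
  ... | inj₂ <y   = ℤ.<⇒≤ <y

  path-height : ∀ {n u w} → Path n u w → height w ≡ height u ℤ.+ + n
  path-height {w = w} []      = sym (ℤ.+-identityʳ (height w))
  path-height {suc n} {u} (e ∷ p) = trans (path-height p)
    (trans (cong (ℤ._+ + n) (height-arc e)) (raise (height u) (+ n)))
    where
    raise : ∀ p q → (1ℤ ℤ.+ p) ℤ.+ q ≡ p ℤ.+ (1ℤ ℤ.+ q)
    raise = solve-∀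

  path-++ : ∀ {m n u v w} → Path m u v → Path n v w → Path (m ℕ.+ n) u w
  path-++ []      q = q
  path-++ (e ∷ p) q = e ∷ path-++ p q

  joined-++ : ∀ {k l z} → Joined k → Joined l → z ∈ k → z ∈ l → Joined (k ++ l)
  joined-++ {k} {l} {z} jk jl z∈k z∈l u∈ v∈ = reach-trans (to-z u∈) (reach-sym (to-z v∈))
    where
    to-z : ∀ {u} → u ∈ k ++ l → Reach (_∈ k ++ l) u z
    to-z u∈ with ∈-++⁻ k u∈
    ... | inj₁ u∈k = reach-map ∈-++⁺ˡ (jk u∈k z∈k)
    ... | inj₂ u∈l = reach-map (∈-++⁺ʳ k) (jl u∈l z∈l)

  Merge : ℕ → Set (a ⊔ ℓ)
  Merge n = ∃[ x ] ∃[ y ] ∃[ z ] ∃[ w ] x ⟶ y × x ⟶ z × y ≢ z × Path n y w × Path n z w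

  Coparents : Set (a ⊔ ℓ)
  Coparents = ∃[ x ] ∃[ y ] ∃[ z ] x ⟶ z × y ⟶ z × x ≢ y

  -- Where the two paths first come together, their previous vertices are distinct.
  meeting⇒coparents : ∀ {n y z w} → y ≢ z → Path n y w → Path n z w → Coparents
  meeting⇒coparents y≢z [] [] = contradiction refl y≢z
  meeting⇒coparents y≢z (_∷_ {v = p} e P) (_∷_ {v = q} f Q) with p ≟ q
  ... | yes refl = _ , _ , p , e , f , y≢z
  ... | no  p≢q  = meeting⇒coparents p≢q P Q

  another-parent : Coparents → ∀ {u v} → u ⟶ v → ∃[ t ] t ⟶ v × t ≢ u
  another-parent (x , y , z , e , f , x≢y) {u} {v} _ with vertex-transitive z v
  ... | g , refl with g · x ≟ u
  ...   | no  gx≢u = g · x , ·-arc g e , gx≢u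
  ...   | yes refl = g · y , ·-arc g f , λ gy≡gx → x≢y (·-injective g (sym gy≡gx))

  module _ {x y z} (x→y : x ⟶ y) (x→z : x ⟶ z) (y≢z : y ≢ z) where

    open Branching x→y x→z y≢z

    run : ℕ → V → V
    run zero    v = v
    run (suc n) v = run n (child v)

    run-path : ∀ n v → Path n v (run n v)
    run-path zero    v = []
    run-path (suc n) v = child-arc v ∷ run-path n (child v)

    spine-path : ∀ m n → Path n (spine m) (spine (n ℕ.+ m))
    spine-path m zero    = []
    spine-path m (suc n) = child-arc (spine m) ∷
      subst (λ k → Path n (spine (suc m)) (spine k)) (ℕ.+-suc n m) (spine-path (suc m) n)

    -- From each of the `suc size` vertices `spine 0` to `spine size`, a path leaves the spine
    -- through the sibling and climbs to the level of `spine (suc size)`. Moved back by an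
    -- automorphism, the ends of these paths lie in a level of `size` vertices, so two coincide. The
    -- earlier path then merges with the spine continued by the later one.
    merge-exists : ∃ Merge
    merge-exists = from-collision (Fin.pigeonhole (ℕ.n<1+n size) (λ m → position (back m)))
      where
      g : Aut
      g = proj₁ (vertex-transitive (spine 0) (spine (suc size)))
      g-top : g · spine 0 ≡ spine (suc size)
      g-top = proj₂ (vertex-transitive (spine 0) (spine (suc size)))
      branch : ∀ m → Path (suc (size ℕ.∸ m)) (spine m) (run (size ℕ.∸ m) (sibling (spine m)))
      branch m = sibling-arc (spine m) ∷ run-path (size ℕ.∸ m) (sibling (spine m))
      final : ℕ → V
      final m = run (size ℕ.∸ m) (sibling (spine m))
      final-height : ∀ m → m ≤ size → height (final m) ≡ height (g · spine 0)
      final-height m m≤ = trans (path-height (branch m)) (trans (cong (ℤ._+ + suc (size ℕ.∸ m)) (height-spine m))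
        (trans (ℤ.+-assoc (height (spine 0)) (+ m) (+ suc (size ℕ.∸ m)))
          (trans (cong (λ k → height (spine 0) ℤ.+ + k) total)
            (trans (sym (height-spine (suc size))) (cong height (sym g-top))))))
        where
        total : m ℕ.+ suc (size ℕ.∸ m) ≡ suc size
        total = trans (ℕ.+-suc m _) (cong suc (ℕ.m+[n∸m]≡n m≤))
      returns : ∀ m → m ≤ size → height (g ⁻¹ · final m) ≡ height (spine 0)
      returns m m≤ = level-preserved g (spine 0) (final m) (final-height m m≤)
      same-length : ∀ {n n′ u v w} → height u ≡ height v → Path n u w → Path n′ v w → n ≡ n′
      same-length {n} {n′} {u} eq p q = ℤ.+-injective
        (ℤ+.∙-cancelˡ (height u) (+ n) (+ n′) (trans (sym (path-height p))
          (trans (path-height q) (cong (ℤ._+ + n′) (sym eq)))))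
      merge : ∀ i j → i < j → final i ≡ final j → ∃ Merge
      merge i j i<j eq = size ℕ.∸ i , spine i , sibling (spine i) , spine (suc i) , final i ,
        sibling-arc (spine i) , child-arc (spine i) , (λ eq′ → child≢sibling (spine i) (sym eq′)) ,
        run-path (size ℕ.∸ i) (sibling (spine i)) , subst (λ n → Path n (spine (suc i)) (final i)) len detour
        where
        detour : Path (j ℕ.∸ suc i ℕ.+ suc (size ℕ.∸ j)) (spine (suc i)) (final i)
        detour = path-++ (subst (λ k → Path (j ℕ.∸ suc i) (spine (suc i)) (spine k)) (ℕ.m∸n+n≡m i<j)
                   (spine-path (suc i) (j ℕ.∸ suc i)))
                   (subst (Path _ (spine j)) (sym eq) (branch j))
        len : j ℕ.∸ suc i ℕ.+ suc (size ℕ.∸ j) ≡ size ℕ.∸ i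
        len = same-length (siblings-level (child-arc (spine i)) (sibling-arc (spine i)))
                detour (run-path (size ℕ.∸ i) (sibling (spine i)))
      back : (m : Fin (suc size)) → height (g ⁻¹ · final (toℕ m)) ≡ height (spine 0)
      back m = returns (toℕ m) (ℕ.s≤s⁻¹ (Fin.toℕ<n m))
      from-collision : ∃[ i ] ∃[ j ] toℕ i < toℕ j × position (back i) ≡ position (back j) → ∃ Merge
      from-collision (i , j , i<j , eq) = merge (toℕ i) (toℕ j) i<j (·-injective (g ⁻¹)
        (trans (sym (at-position (back i))) (trans (cong at eq) (at-position (back j)))))

  module _ (no-diamond : ∀ {x y z w} → x ⟶ y → x ⟶ z → y ⟶ w → z ⟶ w → y ≡ z) where

    -- In a shortest merge, z can be replaced by another in-neighbour t of its
    -- successor q without changing the relations to the remaining vertices of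
    -- the two paths.  The resulting automorphism shows that z and t are
    -- siblings, which contradicts no-diamond at q.
    no-merge : ∀ n → Merge n → ⊥
    no-merge = <-rec (λ n → Merge n → ⊥) go
      where
      go : ∀ n → (∀ {m} → m < n → Merge m → ⊥) → Merge n → ⊥
      go .0 rec (x , y , .y , .y , e , f , y≢z , [] , []) = y≢z refl
      go .1 rec (x , y , z , w , e , f , y≢z , p ∷ [] , q ∷ []) = y≢z (no-diamond e f p q)
      go (suc (suc n)) rec (x , y , z , w , e , f , y≢z , _∷_ {v = p} y→p P , _∷_ {v = q} z→q Q)
        with another-parent (meeting⇒coparents y≢z (y→p ∷ P) (z→q ∷ Q)) z→q
      ... | t , t→q , t≢z = t≢z (sym (no-diamond gx→z gx→t z→q t→q))
        where
        l : List V
        l = verts (y→p ∷ P) ++ verts Q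

        p≢q : p ≢ q
        p≢q refl = y≢z (no-diamond e f y→p z→q)

        y≡z : height y ≡ height z
        y≡z = siblings-level e f

        t≡z : height t ≡ height z
        t≡z = coparents-level t→q z→q

        z↛p : ¬ z ⟶ p
        z↛p c = y≢z (no-diamond e f y→p c)

        -- Otherwise `p` and `q` would be siblings under `t` that merge one step sooner.
        t↛p : ¬ t ⟶ p
        t↛p c = rec (ℕ.n<1+n (suc n)) (t , p , q , w , c , t→q , p≢q , P , Q)

        t≢y : t ≢ y
        t≢y refl = y≢z (no-diamond e f t→q z→q)

        member : ∀ {v} → v ∈ l → v ≡ y ⊎ (v ≡ p ⊎ v ≡ q) ⊎ height q ℤ.< height v
        member {v} v∈ with ∈-++⁻ (verts (y→p ∷ P)) v∈
        ... | inj₁ (here v≡y) = inj₁ v≡y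
        ... | inj₁ (there v∈P) with verts-above P v∈P
        ...   | inj₁ v≡p = inj₂ (inj₁ (inj₁ v≡p))
        ...   | inj₂ p<v = inj₂ (inj₂ (subst (ℤ._< height v) (trans (height-arc y→p)
                             (trans (cong ℤ.suc y≡z) (sym (height-arc z→q)))) p<v))
        member v∈ | inj₂ v∈Q with verts-above Q v∈Q
        ...   | inj₁ v≡q = inj₂ (inj₁ (inj₂ v≡q))
        ...   | inj₂ q<v = inj₂ (inj₂ q<v)

        z≤ : ∀ {v} → v ∈ l → height z ℤ.≤ height v
        z≤ v∈ with ∈-++⁻ (verts (y→p ∷ P)) v∈
        ... | inj₁ v∈P = ℤ.≤-trans (ℤ.≤-reflexive (sym y≡z)) (verts-≥ (y→p ∷ P) v∈P)
        ... | inj₂ v∈Q = ℤ.≤-trans (ℤ.<⇒≤ (height-< z→q)) (verts-≥ Q v∈Q)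

        off : ∀ {v} → height v ≡ height z → v ≢ y → v ∉ l
        off v≡z v≢y v∈ with member v∈
        ... | inj₁ v≡y = v≢y v≡y
        ... | inj₂ (inj₁ (inj₁ refl)) = ℤ.<-irrefl (trans y≡z (sym v≡z)) (height-< y→p)
        ... | inj₂ (inj₁ (inj₂ refl)) = ℤ.<-irrefl (sym v≡z) (height-< z→q)
        ... | inj₂ (inj₂ q<v) = ℤ.<-irrefl (sym v≡z) (ℤ.<-trans (height-< z→q) q<v)

        out-alike : ∀ v → v ∈ l → (z ⟶ v) ⇔ (t ⟶ v)
        out-alike v v∈ with member v∈
        ... | inj₁ refl = impossible (no-descent (ℤ.≤-reflexive y≡z)) (no-descent (ℤ.≤-reflexive (trans y≡z (sym t≡z))))
        ... | inj₂ (inj₁ (inj₁ refl)) = impossible z↛p t↛p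
        ... | inj₂ (inj₁ (inj₂ refl)) = mk⇔ (λ _ → t→q) (λ _ → z→q)
        ... | inj₂ (inj₂ q<v) = impossible (no-jump z→q q<v) (no-jump t→q q<v)

        in-alike : ∀ v → v ∈ l → (v ⟶ z) ⇔ (v ⟶ t)
        in-alike v v∈ = impossible (no-descent (z≤ v∈)) (no-descent (ℤ.≤-trans (ℤ.≤-reflexive t≡z) (z≤ v∈)))

        extension : Σ[ g ∈ Aut ] (g · z ≡ t × (∀ v → v ∈ l → g · v ≡ v))
        extension = extend l
          (joined-++ (verts-joined (y→p ∷ P)) (verts-joined Q) (end∈ (y→p ∷ P)) (end∈ Q))
          (off refl (λ z≡y → y≢z (sym z≡y))) (off t≡z t≢y)
          (inj₂ (q , ∈-++⁺ʳ (verts (y→p ∷ P)) (start∈ Q) , fwd z→q)) (out-alike , in-alike)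

        g : Aut
        g = proj₁ extension

        gx→y : g · x ⟶ y
        gx→y = subst (g · x ⟶_) (proj₂ (proj₂ extension) y (here refl)) (·-arc g e)

        -- As `g` fixes `y`, the vertex `g · x` is an in-neighbour of `y`, and the siblings `y` and
        -- `z` have the same in-neighbours.
        gx→z : g · x ⟶ z
        gx→z = rectangle e f gx→y

        gx→t : g · x ⟶ t
        gx→t = subst (g · x ⟶_) (proj₁ (proj₂ extension)) (·-arc g f)

  siblings-same-out : ∀ {x y z w} → x ⟶ y → x ⟶ z → y ⟶ w → z ⟶ w
  siblings-same-out {x} {y} {z} {w} e f c with decˡ (z ⟶ w)
  ... | yes c′ = c′
  ... | no  z↛w = ⊥-elim (no-merge no-diamond _ (proj₂ (merge-exists e f y≢z)))
    where
    y≢z : y ≢ z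
    y≢z refl = z↛w c
    no-diamond : ∀ {x y z w} → x ⟶ y → x ⟶ z → y ⟶ w → z ⟶ w → y ≡ z
    no-diamond {x′} {y′} {z′} e′ f′ c′ d′ = decidable-stable (y′ ≟ z′) λ y′≢z′ →
      case claw-transitive e f y≢z e′ f′ y′≢z′ of λ where
        -- The common out-neighbour is a sibling of `g · w` under `y′`, so `rectangle` turns the arc
        -- from `z′` to it into an arc from `z′` to `g · w`.
        (g , refl , refl , refl) → z↛w (·-arc⁻ g (rectangle c′ (·-arc g c) d′))

-- Reversal of arcs

opposite : ∀ {a ℓ} → Digraph a ℓ → Digraph a ℓ
opposite D = record
  { Vertex = D.Vertex
  ; _⟶_ = flip D._⟶_
  ; irrefl = λ u≡v e → D.irrefl (sym u≡v) e
  ; antisym = λ e e′ → D.antisym e′ e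
  }
  where module D = Digraph D

module _ {a ℓ} (D : Digraph a ℓ) where
  private
    module E = Digraph (opposite D)

  opposite-adj : ∀ {u v} → Digraph.Adjacent D u v → E.Adjacent u v
  opposite-adj (fwd e) = bwd e
  opposite-adj (bwd e) = fwd e

  opposite-aut : Automorphism D → Automorphism (opposite D)
  opposite-aut g = record { bijection = _≅_.bijection g ; arcs = λ u v → _≅_.arcs g v u }

  opposite-connected : Connected D → Connected (opposite D)
  opposite-connected c u v = go (c u v)
    where
    go : ∀ {u} → Star (Digraph.Adjacent D) u v → Star E.Adjacent u v
    go ε        = ε
    go (e ◅ es) = opposite-adj e ◅ go es

module _ {a ℓ} (D : Digraph a ℓ) where

  opposite-extend : Extension.OnePointExtension D → Extension.OnePointExtension (opposite D)
  opposite-extend extend l jl x∉ x′∉ att (out , inn) with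
    extend l (λ u∈ v∈ → walk (jl u∈ v∈)) x∉ x′∉
      (case att of λ { (inj₁ l≡[]) → inj₁ l≡[] ; (inj₂ (y , y∈ , e)) → inj₂ (y , y∈ , opposite-adj (opposite D) e) })
      (inn , out)
    where
    walk : ∀ {u v} → Walks.Reach (opposite D) (_∈ l) u v → Walks.Reach D (_∈ l) u v
    walk (Walks.stop p)     = Walks.stop p
    walk (Walks.step p e r) = Walks.step p (opposite-adj (opposite D) e) (walk r)
  ... | g , gx≡x′ , fixes = opposite-aut D g , gx≡x′ , fixes

  opposite-grading : Grading D → Grading (opposite D)
  opposite-grading grading = record
    { height = λ v → ℤ.- height v
    ; height-arc = λ {u} {v} e → trans (negate (height v)) (cong (λ i → ℤ.suc (ℤ.- i)) (sym (height-arc e)))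
    ; height-finite = λ k → listed-⊆ (λ v eq → trans (sym (ℤ.neg-involutive (height v))) (cong ℤ.-_ eq))
        (height-finite (ℤ.- k))
    ; successor = predecessor
    ; predecessor = successor
    }
    where
    open Grading grading
    negate : ∀ i → ℤ.- i ≡ 1ℤ ℤ.+ (ℤ.- (1ℤ ℤ.+ i))
    negate = solve-∀

-- Coordinates identifying `D` with some `J r`

module Coordinates {a ℓ} (em : ExcludedMiddle (a ⊔ ℓ)) (D : Digraph a ℓ)
                   (connected : Connected D) (locallyFinite : LocallyFinite D)
                   (vertex-transitive : ∀ u v → Σ[ g ∈ Automorphism D ] _≅_.to g u ≡ v)
                   (grading : Grading D)
                   (siblings : ∀ {x y z w} → Digraph._⟶_ D x y → Digraph._⟶_ D x z → Digraph._⟶_ D y w → Digraph._⟶_ D z w)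
                   (coparents : ∀ {x y z w} → Digraph._⟶_ D y x → Digraph._⟶_ D z x → Digraph._⟶_ D w y → Digraph._⟶_ D w z)
                   (o : Digraph.Vertex D) where

  open Classical {a} {ℓ} em
  open Digraph D renaming (Vertex to V; Adjacent to Adj)
  open Symmetry D
  open Grading grading

  children : List V
  children = deduplicate (λ u v → decᵃ (u ≡ v)) (proj₁ (proj₁ (locallyFinite o)))

  degree : ℕ
  degree = length children

  ∈-children : ∀ {v} → o ⟶ v → v ∈ children
  ∈-children {v} e = ∈-deduplicate⁺ _ (Equivalence.to (proj₂ (proj₁ (locallyFinite o)) v) e)

  children-arc : ∀ {v} → v ∈ children → o ⟶ v
  children-arc {v} v∈ = Equivalence.from (proj₂ (proj₁ (locallyFinite o)) v) (∈-deduplicate⁻ _ _ v∈)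

  moved : V → Aut
  moved u = proj₁ (vertex-transitive o u)

  -- The out-neighbours of every vertex are labelled by transport from those of `o`, so one index
  -- set `Fin degree` serves everywhere.
  child : V → Fin degree → V
  child u k = moved u · lookup children k

  child-arc : ∀ u k → u ⟶ child u k
  child-arc u k = subst (_⟶ child u k) (proj₂ (vertex-transitive o u))
    (·-arc (moved u) (children-arc (∈-lookup k)))

  child-injective : ∀ u {k l} → child u k ≡ child u l → k ≡ l
  child-injective u eq = unique-lookup (Unique.deduplicate-! _ (proj₁ (proj₁ (locallyFinite o))))
    (·-injective (moved u) eq)

  child-surjective : ∀ {u v} → u ⟶ v → ∃[ k ] child u k ≡ v
  child-surjective {u} {v} e = Any.index v∈ , trans (cong (moved u ·_) (sym (Any.lookup-index v∈))) (·-inverseʳ (moved u) v)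
    where
    v∈ : moved u ⁻¹ · v ∈ children
    v∈ = ∈-children (Equivalence.from (_≅_.arcs (moved u) _ _)
      (subst₂ _⟶_ (sym (proj₂ (vertex-transitive o u))) (sym (·-inverseʳ (moved u) v)) e))

  line : ℤ → V
  line (+ zero)       = o
  line (+ suc n)      = proj₁ (successor (line (+ n)))
  line -[1+ zero ]    = proj₁ (predecessor o)
  line -[1+ suc n ]   = proj₁ (predecessor (line -[1+ n ]))

  line-arc : ∀ i → line i ⟶ line (ℤ.suc i)
  line-arc (+ n)        = proj₂ (successor (line (+ n)))
  line-arc -[1+ zero ]  = proj₂ (predecessor o)
  line-arc -[1+ suc n ] = proj₂ (predecessor (line -[1+ n ]))

  line-height : ∀ i → height (line i) ≡ i ℤ.+ height o
  line-height (+ zero)     = sym (ℤ.+-identityˡ (height o))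
  line-height (+ suc n)    = trans (height-arc (line-arc (+ n)))
    (trans (cong ℤ.suc (line-height (+ n))) (sym (ℤ.+-assoc 1ℤ (+ n) (height o))))
  line-height -[1+ zero ]  = trans (sym (ℤ.pred-suc _)) (cong ℤ.pred (sym (height-arc (line-arc -[1+ zero ]))))
  line-height -[1+ suc n ] = trans (sym (ℤ.pred-suc _))
    (trans (cong ℤ.pred (trans (sym (height-arc (line-arc -[1+ suc n ]))) (line-height -[1+ n ])))
      (sym (ℤ.+-assoc ℤ.-1ℤ -[1+ n ] (height o))))

  -- Column `i` consists of the out-neighbours of `line i`, hence lies at the height of
  -- `line (ℤ.suc i)`.
  point : ℤ × Fin degree → V
  point (i , k) = child (line i) k

  point-height : ∀ p → height (point p) ≡ ℤ.suc (proj₁ p) ℤ.+ height o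
  point-height (i , k) = trans (height-arc (child-arc (line i) k))
    (trans (cong ℤ.suc (line-height i)) (sym (ℤ.+-assoc 1ℤ i (height o))))

  point-injective : ∀ {p q} → point p ≡ point q → p ≡ q
  point-injective {i , k} {j , l} eq
    with ℤ+.∙-cancelˡ 1ℤ i j (ℤ+.∙-cancelʳ (height o) (ℤ.suc i) (ℤ.suc j)
      (trans (sym (point-height (i , k))) (trans (cong height eq) (point-height (j , l)))))
  ... | refl = cong (i ,_) (child-injective (line i) eq)

  point-arc : ∀ p q → (point p ⟶ point q) ⇔ (proj₁ q ≡ ℤ.suc (proj₁ p))
  point-arc (i , k) (j , l) = mk⇔
    (λ e → ℤ+.∙-cancelˡ 1ℤ j (ℤ.suc i) (ℤ+.∙-cancelʳ (height o) (ℤ.suc j) (ℤ.suc (ℤ.suc i)) (trans (sym (point-height (j , l)))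
      (trans (height-arc e) (trans (cong ℤ.suc (point-height (i , k)))
        (sym (ℤ.+-assoc 1ℤ (ℤ.suc i) (height o))))))))
    -- The vertices `line (ℤ.suc i)` and `point (i , k)` are siblings under `line i`, so they have
    -- the same out-neighbours.
    (λ { refl → siblings (line-arc i) (child-arc (line i) k) (child-arc (line (ℤ.suc i)) l) })

  -- Being an out-neighbour of some `line i` spreads along edges: forwards because siblings share
  -- out-neighbours, backwards because vertices with a common out-neighbour share in-neighbours.
  point-surjective : ∀ v → ∃[ p ] point p ≡ v
  point-surjective v = go (connected (proj₁ (successor o)) v) (in-next (+ 0) (proj₂ (successor o)))
    where
    in-next : ∀ i {v} → line i ⟶ v → ∃[ p ] point p ≡ v
    in-next i e with child-surjective e
    ... | k , eq = (i , k) , eq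
    along : ∀ {u v} → Adj u v → ∃[ p ] point p ≡ u → ∃[ p ] point p ≡ v
    along (fwd e) ((i , k) , refl) = in-next (ℤ.suc i) (siblings (child-arc (line i) k) (line-arc i) e)
    along (bwd e) ((i , k) , refl) = in-next (ℤ.pred i) (coparents (child-arc (line i) k) e
      (subst (line (ℤ.pred i) ⟶_) (cong line (ℤ.suc-pred i)) (line-arc (ℤ.pred i))))
    go : ∀ {u} → Star Adj u v → ∃[ p ] point p ≡ u → ∃[ p ] point p ≡ v
    go ε        p = p
    go (e ◅ es) p = go es (along e p)

  isomorphic : D ≅ J degree
  isomorphic = record
    { bijection = mk↔ₛ′ (proj₁ ∘ point-surjective) point
        (λ p → point-injective (proj₂ (point-surjective (point p)))) (proj₂ ∘ point-surjective)
    ; arcs = λ u v → subst₂ (λ x y → (x ⟶ y) ⇔ (proj₁ (proj₁ (point-surjective v)) ≡ ℤ.suc (proj₁ (proj₁ (point-surjective u)))))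
        (proj₂ (point-surjective u)) (proj₂ (point-surjective v))
        (point-arc (proj₁ (point-surjective u)) (proj₁ (point-surjective v)))
    }

-- The digraphs J r are connected-homogeneous

module Converse {a ℓ} (em : ExcludedMiddle (a ⊔ ℓ)) (D : Digraph a ℓ) {r : ℕ} (iso : D ≅ J r) where

  open Classical {a} {ℓ} em
  open Digraph D renaming (Vertex to V; Adjacent to Adj)
  open Symmetry D
  open Inverse (_≅_.bijection iso) using (to; from; strictlyInverseˡ; strictlyInverseʳ)

  infix 4 _≟_
  _≟_ : DecidableEquality V
  u ≟ v = decᵃ (u ≡ v)

  level : V → ℤ
  level v = proj₁ (to v)

  level-arc : ∀ {u v} → (u ⟶ v) ⇔ (level v ≡ ℤ.suc (level u))
  level-arc {u} {v} = _≅_.arcs iso u v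

  Shifts : ℤ → (V → V) → Set a
  Shifts c f = ∀ v → level (f v) ≡ level v ℤ.+ c

  -- Arcs depend only on the levels of their ends, so a bijection need only shift all levels alike.
  level-shift : ∀ {c f} (f⁻¹ : V → V) → (∀ v → f (f⁻¹ v) ≡ v) → (∀ v → f⁻¹ (f v) ≡ v) → Shifts c f → Aut
  level-shift {c} {f} f⁻¹ inverseˡ inverseʳ shifts = record
    { bijection = mk↔ₛ′ f f⁻¹ inverseˡ inverseʳ
    ; arcs = λ u v → mk⇔
        (λ e → Equivalence.from level-arc (trans (shifts v)
          (trans (cong (ℤ._+ c) (Equivalence.to level-arc e)) (sym (shifted u)))))
        (λ e → Equivalence.from level-arc (ℤ+.∙-cancelʳ c (level v) (ℤ.suc (level u))
          (trans (sym (shifts v)) (trans (Equivalence.to level-arc e) (shifted u)))))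
    }
    where
    shifted : ∀ u → ℤ.suc (level (f u)) ≡ ℤ.suc (level u) ℤ.+ c
    shifted u = trans (cong ℤ.suc (shifts u)) (sym (ℤ.+-assoc 1ℤ (level u) c))

  translate : ℤ → V → V
  translate c v = from (level v ℤ.+ c , proj₂ (to v))

  translate-shifts : ∀ c → Shifts c (translate c)
  translate-shifts c v = cong proj₁ (strictlyInverseˡ _)

  translate-cancel : ∀ c d → c ℤ.+ d ≡ 0ℤ → ∀ v → translate d (translate c v) ≡ v
  translate-cancel c d c+d≡0 v = trans (cong (λ p → from (proj₁ p ℤ.+ d , proj₂ p)) (strictlyInverseˡ _))
    (trans (cong (λ i → from (i , proj₂ (to v))) (trans (ℤ.+-assoc (level v) c d)
      (trans (cong (ℤ._+_ (level v)) c+d≡0) (ℤ.+-identityʳ (level v))))) (strictlyInverseʳ v))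

  translation : ℤ → Aut
  translation c = level-shift (translate (ℤ.- c)) (translate-cancel (ℤ.- c) c (ℤ.+-inverseˡ c))
    (translate-cancel c (ℤ.- c) (ℤ.+-inverseʳ c)) (translate-shifts c)

  exchange : V → V → V → V
  exchange x y v with v ≟ x | v ≟ y
  ... | yes _ | _     = y
  ... | no _  | yes _ = x
  ... | no _  | no _  = v

  exchange-x : ∀ x y → exchange x y x ≡ y
  exchange-x x y with x ≟ x | x ≟ y
  ... | yes _  | _ = refl
  ... | no x≢x | _ = contradiction refl x≢x

  exchange-y : ∀ x y → exchange x y y ≡ x
  exchange-y x y with y ≟ x | y ≟ y
  ... | yes y≡x | _      = y≡x
  ... | no _    | yes _  = refl
  ... | no _    | no y≢y = contradiction refl y≢y

  exchange-other : ∀ {x y v} → v ≢ x → v ≢ y → exchange x y v ≡ v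
  exchange-other {x} {y} {v} v≢x v≢y with v ≟ x | v ≟ y
  ... | yes v≡x | _       = contradiction v≡x v≢x
  ... | no _    | yes v≡y = contradiction v≡y v≢y
  ... | no _    | no _    = refl

  exchange-involutive : ∀ x y v → exchange x y (exchange x y v) ≡ v
  exchange-involutive x y v = cases (v ≟ x) (v ≟ y)
    where
    cases : Dec (v ≡ x) → Dec (v ≡ y) → exchange x y (exchange x y v) ≡ v
    cases (yes refl) _          = trans (cong (exchange v y) (exchange-x v y)) (exchange-y v y)
    cases (no _)     (yes refl) = trans (cong (exchange x v) (exchange-y x v)) (exchange-x x v)
    cases (no v≢x)   (no v≢y)   = trans (cong (exchange x y) (exchange-other v≢x v≢y)) (exchange-other v≢x v≢y)

  exchange-level : ∀ {x y} → level x ≡ level y → ∀ v → level (exchange x y v) ≡ level v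
  exchange-level {x} {y} eq v with v ≟ x | v ≟ y
  ... | yes refl | _        = sym eq
  ... | no _     | yes refl = eq
  ... | no _     | no _     = refl

  exchanging : ∀ {x y} → level x ≡ level y → Aut
  exchanging {x} {y} eq = level-shift (exchange x y) (exchange-involutive x y) (exchange-involutive x y)
    λ v → trans (exchange-level eq v) (sym (ℤ.+-identityʳ (level v)))

  module _ {m : ℕ} (s t : Fin m → V) (s-injective : ∀ {i j} → s i ≡ s j → i ≡ j)
           (t-injective : ∀ {i j} → t i ≡ t j → i ≡ j)
           (c : ℤ) (offset : ∀ i → level (t i) ≡ level (s i) ℤ.+ c) where

    -- A translation, corrected by exchanging two vertices of a level at a time.
    match : (l : List (Fin m)) → Σ[ g ∈ Aut ] Shifts c (g ·_) × (∀ i → i ∈ l → g · s i ≡ t i)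
    match []      = translation c , translate-shifts c , λ _ ()
    match (i ∷ l) with match l
    ... | g , shifts , matched = exchanging eq ∙ g ,
          (λ v → trans (exchange-level eq (g · v)) (shifts v)) , λ where
            _ (here refl) → exchange-x (g · s i) (t i)
            j (there j∈)  → trans (cong (exchange (g · s i) (t i)) (matched j j∈)) (unmoved j (matched j j∈))
      where
      eq : level (g · s i) ≡ level (t i)
      eq = trans (shifts (s i)) (sym (offset i))
      -- The exchange affects only `g · s i` and `t i`; by injectivity of `s` and `t`, a matched
      -- `t j` with `j ≢ i` is neither. For `j ≡ i` these two vertices already coincide.
      unmoved : ∀ j → g · s j ≡ t j → exchange (g · s i) (t i) (t j) ≡ t j
      unmoved j gsj≡tj with j Fin.≟ i
      ... | yes refl = trans (exchange-y (g · s i) (t i)) gsj≡tj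
      ... | no j≢i   = exchange-other
              (λ tj≡gsi → j≢i (s-injective (·-injective g (trans gsj≡tj tj≡gsi))))
              (λ tj≡ti → j≢i (t-injective tj≡ti))

  -- Since `φ` preserves arcs and its domain is connected, it changes the level by the same `c`
  -- everywhere. This `c` is read off at position `zero`, so the empty subdigraph is treated apart.
  homogeneous : ConnectedHomogeneous D
  homogeneous {zero}  ι κ _ _ φ = idAut , λ ()
  homogeneous {suc m} ι κ connected _ φ = proj₁ matching , λ i → proj₂ (proj₂ matching) i (∈-allFin i)
    where
    s t : Fin (suc m) → V
    s = Injection.to ι
    t = Injection.to κ ∘ _≅_.to φ
    c : ℤ
    c = level (t zero) ℤ.- level (s zero)
    start : level (t zero) ≡ level (s zero) ℤ.+ c
    start = cancel (level (s zero)) (level (t zero))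
      where
      cancel : ∀ p q → q ≡ p ℤ.+ (q ℤ.- p)
      cancel = solve-∀
    along : ∀ {i j} → Digraph.Adjacent (induced D ι) i j → level (t i) ≡ level (s i) ℤ.+ c → level (t j) ≡ level (s j) ℤ.+ c
    along {i} {j} (fwd e) eq = trans (Equivalence.to level-arc (Equivalence.to (_≅_.arcs φ i j) e))
      (trans (cong ℤ.suc eq) (trans (sym (ℤ.+-assoc 1ℤ (level (s i)) c))
        (cong (ℤ._+ c) (sym (Equivalence.to level-arc e)))))
    along {i} {j} (bwd e) eq = ℤ+.∙-cancelˡ 1ℤ _ _
      (trans (sym (Equivalence.to level-arc (Equivalence.to (_≅_.arcs φ j i) e)))
        (trans eq (trans (cong (ℤ._+ c) (Equivalence.to level-arc e)) (ℤ.+-assoc 1ℤ (level (s j)) c))))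
    go : ∀ {i j} → Star (Digraph.Adjacent (induced D ι)) i j →
         level (t i) ≡ level (s i) ℤ.+ c → level (t j) ≡ level (s j) ℤ.+ c
    go ε        eq = eq
    go (e ◅ es) eq = go es (along e eq)
    t-injective : ∀ {i j} → t i ≡ t j → i ≡ j
    t-injective {i} {j} eq = trans (sym (Inverse.strictlyInverseʳ (_≅_.bijection φ) i))
      (trans (cong (_≅_.from φ) (Injection.injective κ eq)) (Inverse.strictlyInverseʳ (_≅_.bijection φ) j))
    matching : Σ[ g ∈ Aut ] Shifts c (g ·_) × (∀ i → i ∈ allFin (suc m) → g · s i ≡ t i)
    matching = match s t (Injection.injective ι) t-injective c (λ i → go (connected zero i) start) (allFin (suc m))

-- From connected-homogeneity to `J r`

module Homogeneous {a ℓ} (em : ExcludedMiddle (a ⊔ ℓ)) (D : Digraph a ℓ) (connected : Connected D)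
                   (locallyFinite : LocallyFinite D) (homogeneous : ConnectedHomogeneous D) where

  extend : Extension.OnePointExtension D
  extend = Extension.one-point-extension D (λ u v → Classical.decᵃ {a} {ℓ} em (u ≡ v)) homogeneous

  open Transitivity D extend using (vertex-transitive)

  grading : ExactlyTwoEnds D → Grading D
  grading (r , s , r≁s , two) = Orient.grading em D connected locallyFinite r extend H.level H.level-image H.level-finite
    where module H = TwoEnds.Heights em D connected locallyFinite r s r≁s two vertex-transitive

  graded⇒J : Digraph.Vertex D → Grading D → ∃[ r ] D ≅ J r
  graded⇒J o G = _ , Coordinates.isomorphic em D connected locallyFinite vertex-transitive G
    (Layered.siblings-same-out em D connected extend G)
    -- Read in `D`, this says that vertices with a common out-neighbour have the same in-neighbours.
    (Layered.siblings-same-out em (opposite D) (opposite-connected D connected) (opposite-extend D extend) (opposite-grading D G))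
    o

theorem6p2 : {a ℓ : Level} → ExcludedMiddle (a ⊔ ℓ) →
    (D : Digraph a ℓ) → Connected D → LocallyFinite D → ExactlyTwoEnds D →
    ConnectedHomogeneous D ⇔ (∃[ r ] D ≅ J r)
theorem6p2 em D connected locallyFinite ends@(r , _) = mk⇔
  (λ (homogeneous : ConnectedHomogeneous D) → let open Homogeneous em D connected locallyFinite homogeneous in
    graded⇒J (Ray.at r 0) (grading ends))
  (λ (_ , iso) → Converse.homogeneous em D iso)
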